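{- Let $q\ge 6$ be a prime power. A ruled quintic surface $\mathcal V$ of $\mathrm{PG}(6,q)$ contains exactly $q^2$ twisted cubics, and each of them is a directrix of $\mathcal V$, i.e. each lies in a $3$-space disjoint from the plane $\alpha$ of the conic directrix and contains exactly one point of each generator of $\mathcal V$.
   Context: Construction: in $\mathrm{PG}(6,q)$ let $\alpha$ be a plane and $\Pi_3$ a $3$-space with $\alpha\cap\Pi_3=\emptyset$. Let $\mathcal C$ be a non-degenerate conic in $\alpha$ and $\mathcal N_3$ a twisted cubic in $\Pi_3$, parametrised as $\mathcal C=\{(1,\theta,\theta^2)\}$ and $\mathcal N_3=\{(1,\epsilon,\epsilon^2,\epsilon^3)\}$ ($\theta,\epsilon\in\mathbb F_q\cup\{\infty\}$), and let $\phi\in\mathrm{PGL}(2,q)$ act on parameters, giving a bijection $\mathcal C\to\mathcal N_3$. The ruled quintic surface $\mathcal V$ is the set of points on the $q+1$ lines (generators) joining each point of $\mathcal C$ to its image under $\phi$; $\mathcal C$ is its conic directrix. A twisted cubic is a normal rational curve spanning a $3$-space. -}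

module Defs where

open import Level using (Level) renaming (suc to lsuc; zero to lzero)
open import Data.Nat using (ℕ) renaming (_*_ to _*ℕ_)
open import Data.Fin using (Fin; zero; suc)
open import Data.List using (List; length)
open import Data.List.Membership.Propositional using (_∈_)
open import Data.List.Relation.Unary.Unique.Propositional using (Unique)
open import Data.Product using (Σ; ∃; ∃-syntax; _×_; _,_)
open import Data.Sum using (_⊎_)
open import Relation.Binary.PropositionalEquality using (_≡_; _≢_)
open import Relation.Nullary using (¬_; Dec)
open import Algebra.Structures using (IsCommutativeRing)

-- Finite fields (with propositional equality).  The order of a finite
-- field is exactly a prime power, and every prime power occurs, so
-- "q a prime power, GF(q)" is rendered as "a finite field F of size q".

record FiniteField : Set₁ where
  infixl 6 _+_
  infixl 7 _*_
  field
    Carrier : Set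
    _+_ _*_ : Carrier → Carrier → Carrier
    -_      : Carrier → Carrier
    0# 1#   : Carrier
    isCommutativeRing : IsCommutativeRing _≡_ _+_ _*_ -_ 0# 1#
    0≢1     : 0# ≢ 1#
    inverse : ∀ x → x ≢ 0# → ∃[ y ] (x * y ≡ 1#)
    _≟_     : (x y : Carrier) → Dec (x ≡ y)
    elements : List Carrier
    unique   : Unique elements
    complete : ∀ x → x ∈ elements

  size : ℕ
  size = length elements

module Geometry (F : FiniteField) where
  open FiniteField F

  -- Coordinates of PG(6,q): vectors of F^7; points are nonzero vectors
  -- up to nonzero scalars.

  Vec7 : Set
  Vec7 = Fin 7 → Carrier

  0v : Vec7
  0v _ = 0#

  _⊕_ : Vec7 → Vec7 → Vec7
  (u ⊕ v) i = u i + v i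

  _·_ : Carrier → Vec7 → Vec7
  (c · v) i = c * v i

  infixl 6 _⊕_
  infixr 7 _·_

  NonZero : Vec7 → Set
  NonZero v = ¬ (∀ i → v i ≡ 0#)

  _∼_ : Vec7 → Vec7 → Set
  u ∼ v = ∃[ c ] (c ≢ 0# × (∀ i → u i ≡ c * v i))

  comb : (Fin 4 → Carrier) → (Fin 4 → Vec7) → Vec7
  comb c a = c zero · a zero ⊕ c (suc zero) · a (suc zero)
           ⊕ c (suc (suc zero)) · a (suc (suc zero))
           ⊕ c (suc (suc (suc zero))) · a (suc (suc (suc zero)))

  LinIndep4 : (Fin 4 → Vec7) → Set
  LinIndep4 a = ∀ c → (∀ i → comb c a i ≡ 0#) → ∀ j → c j ≡ 0#

  InSpan4 : (Fin 4 → Vec7) → Vec7 → Set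
  InSpan4 a v = ∃[ c ] (∀ i → v i ≡ comb c a i)

  -- Point sets of PG(6,q): predicates on vectors, only ever evaluated at
  -- nonzero vectors.

  PointSet : Set₁
  PointSet = Vec7 → Set

  _⊆P_ : PointSet → PointSet → Set
  S ⊆P T = ∀ v → NonZero v → S v → T v

  _≐_ : PointSet → PointSet → Set
  S ≐ T = (S ⊆P T) × (T ⊆P S)

  -- Twisted cubic: a normal rational curve spanning a 3-space, i.e. the
  -- image of {(1,t,t²,t³)} ∪ {(0,0,0,1)} of PG(3,q) under an injective
  -- linear map into PG(6,q) (columns a₀,…,a₃ linearly independent).

  cubicPt : (Fin 4 → Vec7) → Carrier → Vec7
  cubicPt a t = comb (λ { zero → 1# ; (suc zero) → t
                        ; (suc (suc zero)) → t * t
                        ; (suc (suc (suc zero))) → t * t * t }) a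

  IsTwistedCubic : PointSet → Set
  IsTwistedCubic S =
    ∃[ a ] (LinIndep4 a ×
      (∀ v → NonZero v →
         (S v → (∃[ t ] (v ∼ cubicPt a t)) ⊎ (v ∼ a (suc (suc (suc zero)))))
       × ((∃[ t ] (v ∼ cubicPt a t)) ⊎ (v ∼ a (suc (suc (suc zero)))) → S v)))

  -- The ruled quintic surface.  Coordinates (x₀,…,x₆); the plane α is
  -- x₃=…=x₆=0, the 3-space Π₃ is x₀=x₁=x₂=0.  Parameters θ ∈ F ∪ {∞}
  -- are written homogeneously as (s,t) ≠ (0,0), θ = t/s.
  --   conic point     C(s,t) = (s², st, t², 0,0,0,0)   [(1,θ,θ²)]
  --   cubic point     N(s,t) = (0,0,0, s³, s²t, st², t³) [(1,ε,ε²,ε³)]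
  -- φ ∈ PGL(2,q) is given by a matrix (a b ; c d) with ad − bc ≠ 0,
  -- acting by (s,t) ↦ (a s + b t, c s + d t).

  record PGL2 : Set where
    field
      a b c d : Carrier
      det≢0   : a * d + - (b * c) ≢ 0#

  ParamOK : Carrier → Carrier → Set
  ParamOK s t = ¬ (s ≡ 0# × t ≡ 0#)

  conicPt : Carrier → Carrier → Vec7
  conicPt s t zero = s * s
  conicPt s t (suc zero) = s * t
  conicPt s t (suc (suc zero)) = t * t
  conicPt s t (suc (suc (suc _))) = 0#

  twcPt : Carrier → Carrier → Vec7
  twcPt s t zero = 0#
  twcPt s t (suc zero) = 0#
  twcPt s t (suc (suc zero)) = 0#
  twcPt s t (suc (suc (suc zero))) = s * s * s
  twcPt s t (suc (suc (suc (suc zero)))) = s * s * t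
  twcPt s t (suc (suc (suc (suc (suc zero))))) = s * t * t
  twcPt s t (suc (suc (suc (suc (suc (suc zero)))))) = t * t * t

  module Surface (φ : PGL2) where
    open PGL2 φ

    Generator : Carrier → Carrier → PointSet
    Generator s t v = ∃[ λ₁ ] ∃[ μ ]
      (∀ i → v i ≡ (λ₁ · conicPt s t ⊕ μ · twcPt (a * s + b * t) (c * s + d * t)) i)

    V : PointSet
    V v = ∃[ s ] ∃[ t ] (ParamOK s t × Generator s t v)

    α : PointSet
    α v = ∀ (i : Fin 4) → v (suc (suc (suc i))) ≡ 0#

    InSolidDisjointFromα : PointSet → Set
    InSolidDisjointFromα S =
      ∃[ e ] (LinIndep4 e × (∀ v → NonZero v → S v → InSpan4 e v)
              × (∀ v → NonZero v → InSpan4 e v → ¬ α v))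

    MeetsEachGeneratorOnce : PointSet → Set
    MeetsEachGeneratorOnce S = ∀ s t → ParamOK s t →
      (∃[ v ] (NonZero v × S v × Generator s t v))
      × (∀ v w → NonZero v → NonZero w → S v → Generator s t v
               → S w → Generator s t w → v ∼ w)

    IsDirectrix : PointSet → Set
    IsDirectrix S = InSolidDisjointFromα S × MeetsEachGeneratorOnce S

{-# OPTIONS --safe #-}
module Submission where

-- Write (s,t) for the parameter of a generator.  The twisted cubics are the curves
-- (u s + v t) C(s,t) + N(φ(s,t)), one for each of the q² linear forms u s + v t.
--
-- Conversely, let P(s,t) be a twisted cubic on the surface.  In coordinates x₀,x₁,x₂ on the plane and
-- y₀,…,y₃ on the 3-space in which φ = id, the matrix (x₀ x₁ y₀ y₁ y₂ ; x₁ x₂ y₁ y₂ y₃) has rank 1 on the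
-- surface.  Its minors, evaluated along P, are binary sextics vanishing at the q + 1 ≥ 7 points of the line, so
-- they vanish identically.  If moreover the coordinates are chosen such that P(1,0) lies on the generator of (1,0)
-- outside the plane, then y₁, y₂, y₃ are divisible by t, and comparing coefficients in the minors gives either
-- x₁ = x₂ = y₁ = y₂ = y₃ = 0, impossible since P spans a 3-space, or y = c (f³, f²t, f t², t³) and
-- x = k (f², f t, t²) with linear forms f, k.  Hence P(s,t) is the point with parameter (f,t) of one of the curves above.

open import Defs
open import Data.Nat using (_≤_)
open import Data.List using (List; length)
open import Data.List.Relation.Unary.All using (All)
open import Data.List.Relation.Unary.Any using (Any)
open import Data.List.Relation.Unary.AllPairs using (AllPairs)
open import Data.Product using (Σ; _×_)
open import Relation.Binary.PropositionalEquality using (_≡_)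
open import Relation.Nullary using (¬_)
open import Data.Nat as ℕ using (zero; suc; z≤n; s≤s)
import Data.Nat.Properties as ℕₚ
open import Data.Integer as ℤ using (ℤ; -[1+_]; _⊖_) renaming (+_ to pos)
import Data.Integer.Properties as ℤₚ
open import Data.Sign as Sign using (Sign)
open import Data.Maybe using (Maybe; just; nothing)
open import Data.Fin using (Fin; zero; suc)
open import Data.Fin.Patterns using (0F; 1F; 2F; 3F; 4F; 5F; 6F)
import Data.Fin.Properties as Finₚ
open import Data.Product using (∃-syntax; _,_; proj₁; proj₂; uncurry)
open import Data.Sum using (_⊎_; inj₁; inj₂; [_,_]′)
open import Data.List using ([]; _∷_; map; cartesianProduct)
import Data.List.Properties as Listₚ
import Data.List.Relation.Unary.All as All
import Data.List.Relation.Unary.All.Properties as Allₚ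
import Data.List.Relation.Unary.Any as Any
import Data.List.Relation.Unary.Any.Properties as Anyₚ
import Data.List.Relation.Unary.AllPairs as AllPairs
import Data.List.Relation.Unary.AllPairs.Properties as AllPairsₚ
open import Data.List.Relation.Unary.Unique.Propositional using (Unique)
import Data.List.Relation.Unary.Unique.Propositional.Properties as Uniqueₚ
import Data.List.Membership.Propositional.Properties as ∈ₚ
open import Relation.Nullary using (Dec; yes; no)
open import Relation.Nullary.Negation using (contradiction)
open import Relation.Binary.PropositionalEquality using (refl; sym; trans; cong; cong₂; subst; _≢_; module ≡-Reasoning)
open import Algebra.Bundles using (CommutativeRing)
import Algebra.Solver.Ring as RingSolver
open import Algebra.Solver.Ring.AlmostCommutativeRing using (fromCommutativeRing; _-Raw-AlmostCommutative⟶_)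
import Algebra.Properties.Ring as RingProperties
import Algebra.Properties.AbelianGroup as AbelianGroupProperties
import Algebra.Properties.Semiring.Mult.TCOptimised as Multiples

-- The rank condition could be exploited through unique factorisation of binary forms; the start
-- outside the plane replaces that. Since y₀ does not vanish at (1,0), the quadrics force ever
-- higher powers of t into y₂ and y₃, until the cubic form y₃ can only be c t³. All later divisions
-- are by c t³, which merely shifts coefficients, and c = 0 is the case in which the curve would lie
-- on a single generator. Such a start exists because the plane has only three coordinates and
-- cannot contain four independent vectors. The new coordinates come from a block matrix: the
-- symmetric square of a 2×2 matrix on the plane and the symmetric cube of its product with the
-- inverse of φ on the 3-space. Adjugates invert both blocks up to a power of the determinant, so
-- characteristics 2 and 3 need no separate treatment. The directrix property comes from the same
-- fact: modulo the plane, each of the q² curves is the image of the standard twisted cubic under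
-- the invertible symmetric cube of φ.

module RuledQuintic (F : FiniteField) where
  open FiniteField F
  open Geometry F

  -- Ring solver and field arithmetic

  ring : CommutativeRing _ _
  ring = record { isCommutativeRing = isCommutativeRing }

  open CommutativeRing ring public
    using (+-comm; +-assoc; +-identityˡ; +-identityʳ; -‿inverseʳ; -‿inverseˡ; *-comm; *-assoc; *-identityˡ; *-identityʳ; zeroˡ; zeroʳ)
  open CommutativeRing ring using (semiring; +-abelianGroup) renaming (ring to ring′)
  open RingProperties ring′ using (-‿distribˡ-*; -‿distribʳ-*; -‿involutive; -0#≈0#)
  open AbelianGroupProperties +-abelianGroup using (⁻¹-∙-comm)
  open Multiples semiring renaming (_×_ to _⋅_)

  -- The ring solver has to see that coefficients cancel, which it cannot in the abstract field, so it is run over ℤ.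
  ⟦_⟧ℤ : ℤ → Carrier
  ⟦ pos n ⟧ℤ      = n ⋅ 1#
  ⟦ -[1+ n ] ⟧ℤ = - (suc n ⋅ 1#)

  ⊖-homo : ∀ m n → ⟦ m ⊖ n ⟧ℤ ≡ m ⋅ 1# + - (n ⋅ 1#)
  ⊖-homo m zero = sym (trans (cong ((m ⋅ 1#) +_) -0#≈0#) (+-identityʳ _))
  ⊖-homo zero (suc n) = sym (+-identityˡ _)
  ⊖-homo (suc m) (suc n) = begin
    ⟦ suc m ⊖ suc n ⟧ℤ                          ≡⟨ cong ⟦_⟧ℤ (ℤₚ.[1+m]⊖[1+n]≡m⊖n m n) ⟩
    ⟦ m ⊖ n ⟧ℤ                                  ≡⟨ ⊖-homo m n ⟩
    m ⋅ 1# + - (n ⋅ 1#)                         ≡⟨ cong (_+ - (n ⋅ 1#)) (sym (trans (cong (_+ (m ⋅ 1#)) (-‿inverseˡ 1#)) (+-identityˡ _))) ⟩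
    - 1# + 1# + m ⋅ 1# + - (n ⋅ 1#)             ≡⟨ cong (_+ - (n ⋅ 1#)) (trans (+-assoc _ _ _) (+-comm _ _)) ⟩
    1# + m ⋅ 1# + - 1# + - (n ⋅ 1#)             ≡⟨ +-assoc _ _ _ ⟩
    1# + m ⋅ 1# + (- 1# + - (n ⋅ 1#))           ≡⟨ cong₂ _+_ (sym (1+× m 1#)) (trans (⁻¹-∙-comm 1# _) (cong -_ (sym (1+× n 1#)))) ⟩
    suc m ⋅ 1# + - (suc n ⋅ 1#)                 ∎
    where open ≡-Reasoning

  +-homo : ∀ i j → ⟦ i ℤ.+ j ⟧ℤ ≡ ⟦ i ⟧ℤ + ⟦ j ⟧ℤ
  +-homo (pos m) (pos n) = ×-homo-+ 1# m n
  +-homo (pos m) -[1+ n ] = ⊖-homo m (suc n)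
  +-homo -[1+ m ] (pos n) = trans (⊖-homo n (suc m)) (+-comm _ _)
  +-homo -[1+ m ] -[1+ n ] = trans (cong (λ k → - (k ⋅ 1#)) (cong suc (sym (ℕₚ.+-suc m n))))
    (trans (cong -_ (×-homo-+ 1# (suc m) (suc n))) (sym (⁻¹-∙-comm _ _)))

  ◃-homo⁺ : ∀ n → ⟦ Sign.+ ℤ.◃ n ⟧ℤ ≡ n ⋅ 1#
  ◃-homo⁺ zero = refl
  ◃-homo⁺ (suc n) = refl

  ◃-homo⁻ : ∀ n → ⟦ Sign.- ℤ.◃ n ⟧ℤ ≡ - (n ⋅ 1#)
  ◃-homo⁻ zero = sym -0#≈0#
  ◃-homo⁻ (suc n) = refl

  *-homo : ∀ i j → ⟦ i ℤ.* j ⟧ℤ ≡ ⟦ i ⟧ℤ * ⟦ j ⟧ℤ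
  *-homo (pos m) (pos n) = trans (◃-homo⁺ (m ℕ.* n)) (×1-homo-* m n)
  *-homo (pos m) -[1+ n ] = trans (◃-homo⁻ (m ℕ.* suc n)) (trans (cong -_ (×1-homo-* m (suc n))) (-‿distribʳ-* _ _))
  *-homo -[1+ m ] (pos n) = trans (◃-homo⁻ (suc m ℕ.* n)) (trans (cong -_ (×1-homo-* (suc m) n)) (-‿distribˡ-* _ _))
  *-homo -[1+ m ] -[1+ n ] = trans (◃-homo⁺ (suc m ℕ.* suc n)) (trans (×1-homo-* (suc m) (suc n))
    (sym (trans (sym (-‿distribˡ-* _ _)) (trans (cong -_ (sym (-‿distribʳ-* _ _))) (-‿involutive _)))))

  neg-homo : ∀ i → ⟦ ℤ.- i ⟧ℤ ≡ - ⟦ i ⟧ℤ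
  neg-homo (pos zero) = sym -0#≈0#
  neg-homo (pos (suc n)) = refl
  neg-homo -[1+ n ] = sym (-‿involutive _)

  ℤ⟶F : ℤ.+-*-rawRing -Raw-AlmostCommutative⟶ fromCommutativeRing ring
  ℤ⟶F = record
    { ⟦_⟧ = ⟦_⟧ℤ ; +-homo = +-homo ; *-homo = *-homo ; -‿homo = neg-homo
    ; 0-homo = refl ; 1-homo = refl }

  coefficient≟ : ∀ i j → Maybe (⟦ i ⟧ℤ ≡ ⟦ j ⟧ℤ)
  coefficient≟ i j with i ℤ.≟ j
  ... | yes eq = just (cong ⟦_⟧ℤ eq)
  ... | no _   = nothing

  open RingSolver ℤ.+-*-rawRing (fromCommutativeRing ring) ℤ⟶F coefficient≟ public
    using (Polynomial; con; _:+_; _:*_; :-_; _:=_; solve)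

  :0 :1 : ∀ {n} → Polynomial n
  :0 = con (pos 0)
  :1 = con (pos 1)

  *-cancelˡ-≡0 : ∀ {x y} → x ≢ 0# → x * y ≡ 0# → y ≡ 0#
  *-cancelˡ-≡0 {x} {y} x≢0 xy≡0 with inverse x x≢0
  ... | x⁻¹ , xx⁻¹≡1 = begin
    y               ≡⟨ sym (*-identityˡ y) ⟩
    1# * y          ≡⟨ cong (_* y) (sym xx⁻¹≡1) ⟩
    x * x⁻¹ * y     ≡⟨ solve 3 (λ x x⁻¹ y → x :* x⁻¹ :* y := x⁻¹ :* (x :* y)) refl x x⁻¹ y ⟩
    x⁻¹ * (x * y)   ≡⟨ cong (x⁻¹ *_) xy≡0 ⟩
    x⁻¹ * 0#        ≡⟨ zeroʳ x⁻¹ ⟩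
    0#              ∎
    where open ≡-Reasoning

  *-≢0 : ∀ {x y} → x ≢ 0# → y ≢ 0# → x * y ≢ 0#
  *-≢0 x≢0 y≢0 xy≡0 = y≢0 (*-cancelˡ-≡0 x≢0 xy≡0)

  x*x≡0⇒x≡0 : ∀ {x} → x * x ≡ 0# → x ≡ 0#
  x*x≡0⇒x≡0 {x} xx≡0 with x ≟ 0#
  ... | yes x≡0 = x≡0
  ... | no x≢0  = *-cancelˡ-≡0 x≢0 xx≡0

  x-y≡0⇒x≡y : ∀ {x y} → x + - y ≡ 0# → x ≡ y
  x-y≡0⇒x≡y {x} {y} x-y≡0 = begin
    x               ≡⟨ solve 2 (λ x y → x := (x :+ :- y) :+ y) refl x y ⟩
    (x + - y) + y   ≡⟨ cong (_+ y) x-y≡0 ⟩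
    0# + y          ≡⟨ +-identityˡ y ⟩
    y               ∎
    where open ≡-Reasoning

  x≡y⇒x-y≡0 : ∀ {x y} → x ≡ y → x + - y ≡ 0#
  x≡y⇒x-y≡0 {x} refl = -‿inverseʳ x

  *-cancelˡ : ∀ {x y z} → x ≢ 0# → x * y ≡ x * z → y ≡ z
  *-cancelˡ {x} {y} {z} x≢0 xy≡xz = x-y≡0⇒x≡y (*-cancelˡ-≡0 x≢0
    (trans (solve 3 (λ x y z → x :* (y :+ :- z) := x :* y :+ :- (x :* z)) refl x y z) (x≡y⇒x-y≡0 xy≡xz)))

  length-cartesianProduct : ∀ {A B : Set} (xs : List A) (ys : List B) → length (cartesianProduct xs ys) ≡ length xs ℕ.* length ys
  length-cartesianProduct []       ys = refl
  length-cartesianProduct (x ∷ xs) ys = trans (Listₚ.length-++ (map (x ,_) ys))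
    (cong₂ ℕ._+_ (Listₚ.length-map (x ,_) ys) (length-cartesianProduct xs ys))

  -- Polynomials in one variable, as lists of coefficients with the constant term first.

  eval : List Carrier → Carrier → Carrier
  eval []       x = 0#
  eval (c ∷ cs) x = c + x * eval cs x

  eval-zero : ∀ {cs} → All (_≡ 0#) cs → ∀ x → eval cs x ≡ 0#
  eval-zero All.[] x = refl
  eval-zero (c≡0 All.∷ cs≡0) x = trans (cong₂ (λ c e → c + x * e) c≡0 (eval-zero cs≡0 x))
    (solve 1 (λ x → :0 :+ x :* :0 := :0) refl x)

  constant-term≡0 : ∀ {c cs x} → eval (c ∷ cs) x ≡ 0# → All (_≡ 0#) cs → c ≡ 0#
  constant-term≡0 {c} {cs} {x} e cs≡0 = begin
    c                ≡⟨ solve 2 (λ c x → c := c :+ x :* :0) refl c x ⟩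
    c + x * 0#       ≡⟨ cong (λ e → c + x * e) (sym (eval-zero cs≡0 x)) ⟩
    c + x * eval cs x ≡⟨ e ⟩
    0#               ∎
    where open ≡-Reasoning

  -- quotient r cs is the quotient of c ∷ cs by X − r, for every c.
  quotient : Carrier → List Carrier → List Carrier
  quotient r []       = []
  quotient r (c ∷ cs) = eval (c ∷ cs) r ∷ quotient r cs

  length-quotient : ∀ r cs → length (quotient r cs) ≡ length cs
  length-quotient r []       = refl
  length-quotient r (c ∷ cs) = cong suc (length-quotient r cs)

  -- Synthetic division: the entries of `quotient` are the Horner values at `r` of the tails of the
  -- coefficient list, and the Horner value of the whole list is the remainder.
  eval-quotient : ∀ r c cs x → eval (c ∷ cs) x ≡ eval (c ∷ cs) r + (x + - r) * eval (quotient r cs) x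
  eval-quotient r c []       x = solve 3 (λ r c x → c :+ x :* :0 := c :+ r :* :0 :+ (x :+ :- r) :* :0) refl r c x
  eval-quotient r c (d ∷ ds) x = trans (cong (λ e → c + x * e) (eval-quotient r d ds x))
    (solve 5 (λ r c x e q → c :+ x :* (e :+ (x :+ :- r) :* q) := c :+ r :* e :+ (x :+ :- r) :* (e :+ x :* q)) refl
      r c x (eval (d ∷ ds) r) (eval (quotient r ds) x))

  -- The last Horner value is the leading coefficient; from there downwards, each vanishing value
  -- forces the next coefficient to vanish.
  quotient-zero : ∀ r cs → All (_≡ 0#) (quotient r cs) → All (_≡ 0#) cs
  quotient-zero r [] All.[] = All.[]
  quotient-zero r (c ∷ cs) (e All.∷ es) = let cs≡0 = quotient-zero r cs es in constant-term≡0 e cs≡0 All.∷ cs≡0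

  -- Dividing by X - r removes one coefficient and one root. Any other root x stays a root of the
  -- quotient because x - r ≠ 0, and the root r itself settles the constant term at the end.
  roots⇒zero : ∀ cs rs → Unique rs → length cs ≤ length rs → All (λ r → eval cs r ≡ 0#) rs → All (_≡ 0#) cs
  roots⇒zero [] rs u le es = All.[]
  roots⇒zero (c ∷ cs) (r ∷ rs) (r∉rs AllPairs.∷ u) (s≤s le) (e All.∷ es) = constant-term≡0 e cs≡0 All.∷ cs≡0
    where
    root : ∀ {x} → (r ≢ x) × (eval (c ∷ cs) x ≡ 0#) → eval (quotient r cs) x ≡ 0#
    root {x} (r≢x , ex) = *-cancelˡ-≡0 {x + - r} (λ x-r≡0 → r≢x (sym (x-y≡0⇒x≡y x-r≡0)))
      (trans (sym (+-identityˡ _)) (trans (cong (_+ (x + - r) * eval (quotient r cs) x) (sym e)) (trans (sym (eval-quotient r c cs x)) ex)))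

    cs≡0 : All (_≡ 0#) cs
    cs≡0 = quotient-zero r cs (roots⇒zero (quotient r cs) rs u
      (subst (_≤ length rs) (sym (length-quotient r cs)) le) (All.zipWith root (r∉rs , es)))

  vanishing⇒zero : ∀ cs → length cs ≤ size → (∀ x → eval cs x ≡ 0#) → All (_≡ 0#) cs
  vanishing⇒zero cs le e = roots⇒zero cs elements unique le (All.universal e elements)

  -- Binary cubic forms and their products

  Cubic : Set
  Cubic = Fin 4 → Carrier

  cubic : Carrier → Carrier → Carrier → Carrier → Cubic
  cubic p₀ p₁ p₂ p₃ 0F = p₀
  cubic p₀ p₁ p₂ p₃ 1F = p₁
  cubic p₀ p₁ p₂ p₃ 2F = p₂
  cubic p₀ p₁ p₂ p₃ 3F = p₃

  infix 4 _≗_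
  _≗_ : ∀ {n} → (Fin n → Carrier) → (Fin n → Carrier) → Set
  p ≗ q = ∀ i → p i ≡ q i

  cubic-η : ∀ {p : Cubic} {a b c d} → p 0F ≡ a → p 1F ≡ b → p 2F ≡ c → p 3F ≡ d → p ≗ cubic a b c d
  cubic-η e₀ e₁ e₂ e₃ 0F = e₀
  cubic-η e₀ e₁ e₂ e₃ 1F = e₁
  cubic-η e₀ e₁ e₂ e₃ 2F = e₂
  cubic-η e₀ e₁ e₂ e₃ 3F = e₃

  _∙_ : Cubic → Cubic → Carrier
  p ∙ q = p 0F * q 0F + p 1F * q 1F + p 2F * q 2F + p 3F * q 3F

  ∙-cong : ∀ {p p′ q q′} → p ≗ p′ → q ≗ q′ → p ∙ q ≡ p′ ∙ q′
  ∙-cong e f = cong₂ _+_ (cong₂ _+_ (cong₂ _+_ (cong₂ _*_ (e 0F) (f 0F)) (cong₂ _*_ (e 1F) (f 1F))) (cong₂ _*_ (e 2F) (f 2F))) (cong₂ _*_ (e 3F) (f 3F))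

  monomials : Carrier → Carrier → Cubic
  monomials s t = cubic (s * s * s) (s * s * t) (s * t * t) (t * t * t)

  form : Cubic → Carrier → Carrier → Carrier
  form p s t = monomials s t ∙ p

  product : Cubic → Cubic → Fin 7 → Carrier
  product p q 0F = p 0F * q 0F
  product p q 1F = p 0F * q 1F + p 1F * q 0F
  product p q 2F = p 0F * q 2F + p 1F * q 1F + p 2F * q 0F
  product p q 3F = p 0F * q 3F + p 1F * q 2F + p 2F * q 1F + p 3F * q 0F
  product p q 4F = p 1F * q 3F + p 2F * q 2F + p 3F * q 1F
  product p q 5F = p 2F * q 3F + p 3F * q 2F
  product p q 6F = p 3F * q 3F

  sextic : (Fin 7 → Carrier) → Carrier → Carrier
  sextic c x = c 0F + x * (c 1F + x * (c 2F + x * (c 3F + x * (c 4F + x * (c 5F + x * c 6F)))))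

  :form : ∀ {n} (p₀ p₁ p₂ p₃ s t : Polynomial n) → Polynomial n
  :form p₀ p₁ p₂ p₃ s t = s :* s :* s :* p₀ :+ s :* s :* t :* p₁ :+ s :* t :* t :* p₂ :+ t :* t :* t :* p₃

  form-product : ∀ p q x → form p 1# x * form q 1# x ≡ sextic (product p q) x
  form-product p q = solve 9 (λ p₀ p₁ p₂ p₃ q₀ q₁ q₂ q₃ x → :form p₀ p₁ p₂ p₃ :1 x :* :form q₀ q₁ q₂ q₃ :1 x :=
      p₀ :* q₀ :+ x :* (p₀ :* q₁ :+ p₁ :* q₀ :+ x :* (p₀ :* q₂ :+ p₁ :* q₁ :+ p₂ :* q₀ :+ x :* (
      p₀ :* q₃ :+ p₁ :* q₂ :+ p₂ :* q₁ :+ p₃ :* q₀ :+ x :* (p₁ :* q₃ :+ p₂ :* q₂ :+ p₃ :* q₁ :+ x :* (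
      p₂ :* q₃ :+ p₃ :* q₂ :+ x :* (p₃ :* q₃))))))) refl
    (p 0F) (p 1F) (p 2F) (p 3F) (q 0F) (q 1F) (q 2F) (q 3F)

  form-∞ : ∀ p → form p 0# 1# ≡ p 3F
  form-∞ p = solve 4 (λ p₀ p₁ p₂ p₃ → :form p₀ p₁ p₂ p₃ :0 :1 := p₃) refl (p 0F) (p 1F) (p 2F) (p 3F)

  form-scale : ∀ ρ p s t → form p (ρ * s) (ρ * t) ≡ ρ * ρ * ρ * form p s t
  form-scale ρ p s t = solve 7 (λ a b c d ρ s t → :form a b c d (ρ :* s) (ρ :* t) := ρ :* ρ :* ρ :* :form a b c d s t) refl (p 0F) (p 1F) (p 2F) (p 3F) ρ s t

  1≢0 : 1# ≢ 0#
  1≢0 1≡0 = 0≢1 (sym 1≡0)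

  1-x-ok : ∀ {x} → ParamOK 1# x
  1-x-ok (1≡0 , _) = 1≢0 1≡0

  x-1-ok : ∀ {x} → ParamOK x 1#
  x-1-ok (_ , 1≡0) = 1≢0 1≡0

  -- A binary sextic vanishing on the whole projective line is zero: its
  -- coefficient of t⁶ is the value at (0,1), and the quintic left over has q ≥ 6 roots.
  product-unique : 6 ≤ size → ∀ {p q r u} →
    (∀ s t → ParamOK s t → form p s t * form q s t ≡ form r s t * form u s t) → product p q ≗ product r u
  product-unique 6≤q {p} {q} {r} {u} e = equal (vanishing⇒zero differences 6≤q vanish)
    where
    c d : Fin 7 → Carrier
    c = product p q
    d = product r u

    differences : List Carrier
    differences = (c 0F + - d 0F) ∷ (c 1F + - d 1F) ∷ (c 2F + - d 2F) ∷ (c 3F + - d 3F) ∷ (c 4F + - d 4F) ∷ (c 5F + - d 5F) ∷ []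

    leading : c 6F ≡ d 6F
    leading = trans (cong₂ _*_ (sym (form-∞ p)) (sym (form-∞ q))) (trans (e 0# 1# x-1-ok) (cong₂ _*_ (form-∞ r) (form-∞ u)))

    vanish : ∀ x → eval differences x ≡ 0#
    vanish x = begin
      -- The variable z stands for a common coefficient of degree six, which cancels in the
      -- difference and turns the two quintics into sextics.
      eval differences x ≡⟨ solve 14 (λ c₀ c₁ c₂ c₃ c₄ c₅ d₀ d₁ d₂ d₃ d₄ d₅ z x →
         (c₀ :+ :- d₀) :+ x :* ((c₁ :+ :- d₁) :+ x :* ((c₂ :+ :- d₂) :+ x :* ((c₃ :+ :- d₃) :+ x :* ((c₄ :+ :- d₄) :+ x :* ((c₅ :+ :- d₅) :+ x :* :0))))) :=
         (c₀ :+ x :* (c₁ :+ x :* (c₂ :+ x :* (c₃ :+ x :* (c₄ :+ x :* (c₅ :+ x :* z)))))) :+ :-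
         (d₀ :+ x :* (d₁ :+ x :* (d₂ :+ x :* (d₃ :+ x :* (d₄ :+ x :* (d₅ :+ x :* z)))))) )
         refl (c 0F) (c 1F) (c 2F) (c 3F) (c 4F) (c 5F) (d 0F) (d 1F) (d 2F) (d 3F) (d 4F) (d 5F) (c 6F) x ⟩
      sextic c x + - tail (c 6F) ≡⟨ cong (λ z → sextic c x + - tail z) leading ⟩
      sextic c x + - sextic d x ≡⟨ cong₂ (λ y z → y + - z) (sym (form-product p q x)) (sym (form-product r u x)) ⟩
      form p 1# x * form q 1# x + - (form r 1# x * form u 1# x) ≡⟨ x≡y⇒x-y≡0 (e 1# x 1-x-ok) ⟩
      0# ∎
      where
      open ≡-Reasoning
      tail : Carrier → Carrier
      tail z = d 0F + x * (d 1F + x * (d 2F + x * (d 3F + x * (d 4F + x * (d 5F + x * z)))))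

    equal : All (_≡ 0#) differences → c ≗ d
    equal (e₀ All.∷ _) 0F = x-y≡0⇒x≡y e₀
    equal (_ All.∷ e₁ All.∷ _) 1F = x-y≡0⇒x≡y e₁
    equal (_ All.∷ _ All.∷ e₂ All.∷ _) 2F = x-y≡0⇒x≡y e₂
    equal (_ All.∷ _ All.∷ _ All.∷ e₃ All.∷ _) 3F = x-y≡0⇒x≡y e₃
    equal (_ All.∷ _ All.∷ _ All.∷ _ All.∷ e₄ All.∷ _) 4F = x-y≡0⇒x≡y e₄
    equal (_ All.∷ _ All.∷ _ All.∷ _ All.∷ _ All.∷ e₅ All.∷ _) 5F = x-y≡0⇒x≡y e₅
    equal _ 6F = leading

  -- Four coefficients against q ≥ 6 affine roots.
  form-vanishing⇒zero : 6 ≤ size → ∀ p → (∀ x → form p 1# x ≡ 0#) → ∀ i → p i ≡ 0#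
  form-vanishing⇒zero 6≤q p e = zeros (vanishing⇒zero (p 0F ∷ p 1F ∷ p 2F ∷ p 3F ∷ []) (ℕₚ.≤-trans (s≤s (s≤s (s≤s (s≤s z≤n)))) 6≤q)
      (λ x → trans (solve 5 (λ p₀ p₁ p₂ p₃ x → p₀ :+ x :* (p₁ :+ x :* (p₂ :+ x :* (p₃ :+ x :* :0))) := :form p₀ p₁ p₂ p₃ :1 x) refl
        (p 0F) (p 1F) (p 2F) (p 3F) x) (e x)))
    where
    zeros : All (_≡ 0#) (p 0F ∷ p 1F ∷ p 2F ∷ p 3F ∷ []) → ∀ i → p i ≡ 0#
    zeros (e₀ All.∷ _) 0F = e₀
    zeros (_ All.∷ e₁ All.∷ _) 1F = e₁
    zeros (_ All.∷ _ All.∷ e₂ All.∷ _) 2F = e₂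
    zeros (_ All.∷ _ All.∷ _ All.∷ e₃ All.∷ _) 3F = e₃

  product-cong : ∀ {p p′ q q′} → p ≗ p′ → q ≗ q′ → product p q ≗ product p′ q′
  product-cong e f 0F = cong₂ _*_ (e 0F) (f 0F)
  product-cong e f 1F = cong₂ _+_ (cong₂ _*_ (e 0F) (f 1F)) (cong₂ _*_ (e 1F) (f 0F))
  product-cong e f 2F = cong₂ _+_ (cong₂ _+_ (cong₂ _*_ (e 0F) (f 2F)) (cong₂ _*_ (e 1F) (f 1F))) (cong₂ _*_ (e 2F) (f 0F))
  product-cong e f 3F = cong₂ _+_ (cong₂ _+_ (cong₂ _+_ (cong₂ _*_ (e 0F) (f 3F)) (cong₂ _*_ (e 1F) (f 2F))) (cong₂ _*_ (e 2F) (f 1F))) (cong₂ _*_ (e 3F) (f 0F))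
  product-cong e f 4F = cong₂ _+_ (cong₂ _+_ (cong₂ _*_ (e 1F) (f 3F)) (cong₂ _*_ (e 2F) (f 2F))) (cong₂ _*_ (e 3F) (f 1F))
  product-cong e f 5F = cong₂ _+_ (cong₂ _*_ (e 2F) (f 3F)) (cong₂ _*_ (e 3F) (f 2F))
  product-cong e f 6F = cong₂ _*_ (e 3F) (f 3F)

  Zero : Cubic → Set
  Zero p = ∀ i → p i ≡ 0#

  product-zeroʳ : ∀ p {q} → Zero q → ∀ j → product p q j ≡ 0#
  product-zeroʳ p {q} q≡0 j = trans (product-cong {p} (λ _ → refl) q≡0 j) (zeros j)
    where
    zeros : ∀ j → product p (λ _ → 0#) j ≡ 0#
    zeros 0F = zeroʳ (p 0F)
    zeros 1F = solve 2 (λ a b → a :* :0 :+ b :* :0 := :0) refl (p 0F) (p 1F)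
    zeros 2F = solve 3 (λ a b c → a :* :0 :+ b :* :0 :+ c :* :0 := :0) refl (p 0F) (p 1F) (p 2F)
    zeros 3F = solve 4 (λ a b c d → a :* :0 :+ b :* :0 :+ c :* :0 :+ d :* :0 := :0) refl (p 0F) (p 1F) (p 2F) (p 3F)
    zeros 4F = solve 3 (λ a b c → a :* :0 :+ b :* :0 :+ c :* :0 := :0) refl (p 1F) (p 2F) (p 3F)
    zeros 5F = solve 2 (λ a b → a :* :0 :+ b :* :0 := :0) refl (p 2F) (p 3F)
    zeros 6F = zeroʳ (p 3F)

  -- A triangular system with `q 0F` on the diagonal: the coefficients of `p` vanish from the lowest
  -- upwards.
  product≡0⇒zero : ∀ {p q} → q 0F ≢ 0# → (∀ j → product p q j ≡ 0#) → Zero p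
  product≡0⇒zero {p} {q} q₀≢0 e = zeros
    where
    p₀≡0 : p 0F ≡ 0#
    p₀≡0 = *-cancelˡ-≡0 q₀≢0 (trans (*-comm _ _) (e 0F))

    p₁≡0 : p 1F ≡ 0#
    p₁≡0 = *-cancelˡ-≡0 q₀≢0 (trans
      (solve 3 (λ p₁ q₀ q₁ → q₀ :* p₁ := :0 :* q₁ :+ p₁ :* q₀) refl (p 1F) (q 0F) (q 1F))
      (trans (cong (λ z → z * q 1F + p 1F * q 0F) (sym p₀≡0)) (e 1F)))

    p₂≡0 : p 2F ≡ 0#
    p₂≡0 = *-cancelˡ-≡0 q₀≢0 (trans
      (solve 4 (λ p₂ q₀ q₁ q₂ → q₀ :* p₂ := :0 :* q₂ :+ :0 :* q₁ :+ p₂ :* q₀) refl (p 2F) (q 0F) (q 1F) (q 2F))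
      (trans (cong₂ (λ y z → y * q 2F + z * q 1F + p 2F * q 0F) (sym p₀≡0) (sym p₁≡0)) (e 2F)))

    p₃≡0 : p 3F ≡ 0#
    p₃≡0 = *-cancelˡ-≡0 q₀≢0 (trans
      (solve 5 (λ p₃ q₀ q₁ q₂ q₃ → q₀ :* p₃ := :0 :* q₃ :+ :0 :* q₂ :+ :0 :* q₁ :+ p₃ :* q₀) refl (p 3F) (q 0F) (q 1F) (q 2F) (q 3F))
      (trans (cong₂ _+_ (cong₂ _+_ (cong₂ (λ y z → y * q 3F + z * q 2F) (sym p₀≡0) (sym p₁≡0)) (cong (_* q 1F) (sym p₂≡0))) refl) (e 3F)))

    zeros : Zero p
    zeros 0F = p₀≡0
    zeros 1F = p₁≡0
    zeros 2F = p₂≡0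
    zeros 3F = p₃≡0

  -- Curves on the surface with φ = id

  -- The two parameters are kept separate so that one expression covers the given surface, where
  -- (σ,τ) is the image of (s,t) under φ, and the normalised one, where they coincide.
  conic+cubic : (λ′ μ s t σ τ : Carrier) → Vec7
  conic+cubic λ′ μ s t σ τ = λ′ · conicPt s t ⊕ μ · twcPt σ τ

  :conic+cubic : ∀ {n} (λ′ μ s t σ τ : Polynomial n) → Fin 7 → Polynomial n
  :conic+cubic λ′ μ s t σ τ 0F = λ′ :* (s :* s) :+ μ :* :0
  :conic+cubic λ′ μ s t σ τ 1F = λ′ :* (s :* t) :+ μ :* :0
  :conic+cubic λ′ μ s t σ τ 2F = λ′ :* (t :* t) :+ μ :* :0
  :conic+cubic λ′ μ s t σ τ 3F = λ′ :* :0 :+ μ :* (σ :* σ :* σ)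
  :conic+cubic λ′ μ s t σ τ 4F = λ′ :* :0 :+ μ :* (σ :* σ :* τ)
  :conic+cubic λ′ μ s t σ τ 5F = λ′ :* :0 :+ μ :* (σ :* τ :* τ)
  :conic+cubic λ′ μ s t σ τ 6F = λ′ :* :0 :+ μ :* (τ :* τ :* τ)

  -- The curves on the surface with φ = id: coordinate i of the curve is the cubic form q i, and the
  -- rows of (x₀ x₁ y₀ y₁ y₂ ; x₁ x₂ y₁ y₂ y₃) are proportional at every point of the surface.
  -- The curve starts on the generator of (1,0).
  module CurvesOnSurface (6≤q : 6 ≤ size) (q : Fin 7 → Cubic)
    (onSurface : ∀ s t → ParamOK s t → ∃[ λ′ ] ∃[ μ ] ∃[ σ ] ∃[ τ ] (∀ i → form (q i) s t ≡ conic+cubic λ′ μ σ τ σ τ i))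
    (start : q 3F 0F ≢ 0#) (start₄ : q 4F 0F ≡ 0#) (start₅ : q 5F 0F ≡ 0#) (start₆ : q 6F 0F ≡ 0#) where

    -- A quadric through the whole surface, pulled back along the curve, is an equality of sextics
    -- at every point of the line, hence of their coefficients.
    quadric : ∀ i j k l → (∀ λ′ μ σ τ → conic+cubic λ′ μ σ τ σ τ i * conic+cubic λ′ μ σ τ σ τ j ≡ conic+cubic λ′ μ σ τ σ τ k * conic+cubic λ′ μ σ τ σ τ l) →
      product (q i) (q j) ≗ product (q k) (q l)
    quadric i j k l vanishes = product-unique 6≤q {q i} {q j} {q k} {q l} λ s t ok → on s t (onSurface s t ok)
      where
      on : ∀ s t → (∃[ λ′ ] ∃[ μ ] ∃[ σ ] ∃[ τ ] (∀ i → form (q i) s t ≡ conic+cubic λ′ μ σ τ σ τ i)) →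
        form (q i) s t * form (q j) s t ≡ form (q k) s t * form (q l) s t
      on s t (λ′ , μ , σ , τ , e) = trans (cong₂ _*_ (e i) (e j)) (trans (vanishes λ′ μ σ τ) (sym (cong₂ _*_ (e k) (e l))))


    y₀y₃≡y₁y₂ : product (q 3F) (q 6F) ≗ product (q 4F) (q 5F)
    y₀y₃≡y₁y₂ = quadric 3F 6F 4F 5F (solve 4 (λ λ′ μ σ τ → let v = :conic+cubic λ′ μ σ τ σ τ in v 3F :* v 6F := v 4F :* v 5F) refl)

    y₀y₂≡y₁y₁ : product (q 3F) (q 5F) ≗ product (q 4F) (q 4F)
    y₀y₂≡y₁y₁ = quadric 3F 5F 4F 4F (solve 4 (λ λ′ μ σ τ → let v = :conic+cubic λ′ μ σ τ σ τ in v 3F :* v 5F := v 4F :* v 4F) refl)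

    y₁y₃≡y₂y₂ : product (q 4F) (q 6F) ≗ product (q 5F) (q 5F)
    y₁y₃≡y₂y₂ = quadric 4F 6F 5F 5F (solve 4 (λ λ′ μ σ τ → let v = :conic+cubic λ′ μ σ τ σ τ in v 4F :* v 6F := v 5F :* v 5F) refl)

    -- Of the mixed minors, the ones with y₃ recover x₁ and x₀ by division when y₃ ≠ 0; the ones
    -- with y₀ make x₁ and x₂ vanish once y₁ does.
    x₁y₃≡x₂y₂ : product (q 1F) (q 6F) ≗ product (q 2F) (q 5F)
    x₁y₃≡x₂y₂ = quadric 1F 6F 2F 5F (solve 4 (λ λ′ μ σ τ → let v = :conic+cubic λ′ μ σ τ σ τ in v 1F :* v 6F := v 2F :* v 5F) refl)

    x₀y₃≡x₁y₂ : product (q 0F) (q 6F) ≗ product (q 1F) (q 5F)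
    x₀y₃≡x₁y₂ = quadric 0F 6F 1F 5F (solve 4 (λ λ′ μ σ τ → let v = :conic+cubic λ′ μ σ τ σ τ in v 0F :* v 6F := v 1F :* v 5F) refl)

    x₁y₀≡x₀y₁ : product (q 1F) (q 3F) ≗ product (q 0F) (q 4F)
    x₁y₀≡x₀y₁ = quadric 1F 3F 0F 4F (solve 4 (λ λ′ μ σ τ → let v = :conic+cubic λ′ μ σ τ σ τ in v 1F :* v 3F := v 0F :* v 4F) refl)

    x₂y₀≡x₁y₁ : product (q 2F) (q 3F) ≗ product (q 1F) (q 4F)
    x₂y₀≡x₁y₁ = quadric 2F 3F 1F 4F (solve 4 (λ λ′ μ σ τ → let v = :conic+cubic λ′ μ σ τ σ τ in v 2F :* v 3F := v 1F :* v 4F) refl)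

    n = q 3F 0F
    a₁ = q 4F 1F
    a₂ = q 4F 2F
    a₃ = q 4F 3F
    b₁ = q 5F 1F
    b₂ = q 5F 2F
    b₃ = q 5F 3F
    c = q 6F 3F

    -- y₁ is divisible by t, so t² divides y₁² = y₀y₂; as y₀ is prime to t, t² divides y₂.
    b₁≡0 : b₁ ≡ 0#
    b₁≡0 = *-cancelˡ-≡0 start (begin
      n * b₁                                   ≡⟨ solve 3 (λ n b₁ z → n :* b₁ := n :* b₁ :+ z :* :0) refl n b₁ (q 3F 1F) ⟩
      n * b₁ + q 3F 1F * 0#                    ≡⟨ cong (λ z → n * b₁ + q 3F 1F * z) (sym start₅) ⟩
      product (q 3F) (q 5F) 1F                 ≡⟨ y₀y₂≡y₁y₁ 1F ⟩
      q 4F 0F * a₁ + a₁ * q 4F 0F              ≡⟨ cong (λ z → z * a₁ + a₁ * z) start₄ ⟩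
      0# * a₁ + a₁ * 0#                        ≡⟨ solve 1 (λ a₁ → :0 :* a₁ :+ a₁ :* :0 := :0) refl a₁ ⟩
      0#                                       ∎)
      where open ≡-Reasoning

    y₁-shape : q 4F ≗ cubic 0# a₁ a₂ a₃
    y₁-shape = cubic-η start₄ refl refl refl

    y₂-shape : q 5F ≗ cubic 0# 0# b₂ b₃
    y₂-shape = cubic-η start₅ b₁≡0 refl refl

    y₀y₃-shape : ∀ j → product (q 3F) (q 6F) j ≡ product (cubic 0# a₁ a₂ a₃) (cubic 0# 0# b₂ b₃) j
    y₀y₃-shape j = trans (y₀y₃≡y₁y₂ j) (product-cong y₁-shape y₂-shape j)

    -- Here t³ divides y₁y₂ = y₀y₃, and y₀ is prime to t, so t³ divides the cubic form y₃. This and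
    -- the next coefficient leave only c t³.
    c₁≡0 : q 6F 1F ≡ 0#
    c₁≡0 = *-cancelˡ-≡0 start (begin
      n * q 6F 1F                              ≡⟨ solve 3 (λ n c z → n :* c := n :* c :+ z :* :0) refl n (q 6F 1F) (q 3F 1F) ⟩
      n * q 6F 1F + q 3F 1F * 0#               ≡⟨ cong (λ z → n * q 6F 1F + q 3F 1F * z) (sym start₆) ⟩
      product (q 3F) (q 6F) 1F                 ≡⟨ y₀y₃-shape 1F ⟩
      0# * 0# + a₁ * 0#                        ≡⟨ solve 1 (λ a₁ → :0 :* :0 :+ a₁ :* :0 := :0) refl a₁ ⟩
      0#                                       ∎)
      where open ≡-Reasoning

    c₂≡0 : q 6F 2F ≡ 0#
    c₂≡0 = *-cancelˡ-≡0 start (begin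
      n * q 6F 2F                              ≡⟨ solve 4 (λ n c y z → n :* c := n :* c :+ y :* :0 :+ z :* :0) refl n (q 6F 2F) (q 3F 1F) (q 3F 2F) ⟩
      n * q 6F 2F + q 3F 1F * 0# + q 3F 2F * 0# ≡⟨ cong₂ (λ y z → n * q 6F 2F + q 3F 1F * y + q 3F 2F * z) (sym c₁≡0) (sym start₆) ⟩
      product (q 3F) (q 6F) 2F                 ≡⟨ y₀y₃-shape 2F ⟩
      0# * b₂ + a₁ * 0# + a₂ * 0#              ≡⟨ solve 3 (λ a₁ a₂ b₂ → :0 :* b₂ :+ a₁ :* :0 :+ a₂ :* :0 := :0) refl a₁ a₂ b₂ ⟩
      0#                                       ∎)
      where open ≡-Reasoning

    y₃-shape : q 6F ≗ cubic 0# 0# 0# c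
    y₃-shape = cubic-η start₆ c₁≡0 c₂≡0 refl

    -- From y₃ = 0 the vanishing spreads through y₂² = y₁y₃ and y₁² = y₀y₂; then x₁y₀ = x₀y₁ and
    -- x₂y₀ = x₁y₁ finish, because y₀ has a non-zero lowest coefficient.
    module Degenerate (c≡0 : c ≡ 0#) where

      y₃≡0 : Zero (q 6F)
      y₃≡0 0F = start₆
      y₃≡0 1F = c₁≡0
      y₃≡0 2F = c₂≡0
      y₃≡0 3F = c≡0

      y₂² : ∀ j → product (cubic 0# 0# b₂ b₃) (cubic 0# 0# b₂ b₃) j ≡ 0#
      y₂² j = trans (sym (product-cong y₂-shape y₂-shape j)) (trans (sym (y₁y₃≡y₂y₂ j)) (product-zeroʳ (q 4F) y₃≡0 j))

      y₂≡0 : Zero (q 5F)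
      y₂≡0 0F = start₅
      y₂≡0 1F = b₁≡0
      y₂≡0 2F = x*x≡0⇒x≡0 (trans (solve 2 (λ b₂ b₃ → b₂ :* b₂ := :0 :* b₃ :+ b₂ :* b₂ :+ b₃ :* :0) refl b₂ b₃) (y₂² 4F))
      y₂≡0 3F = x*x≡0⇒x≡0 (y₂² 6F)

      y₁² : ∀ {p} → q 4F ≗ p → ∀ j → product p p j ≡ 0#
      y₁² e j = trans (sym (product-cong e e j)) (trans (sym (y₀y₂≡y₁y₁ j)) (product-zeroʳ (q 3F) y₂≡0 j))

      a₁≡0 : a₁ ≡ 0#
      a₁≡0 = x*x≡0⇒x≡0 (trans (solve 2 (λ a₁ a₂ → a₁ :* a₁ := :0 :* a₂ :+ a₁ :* a₁ :+ a₂ :* :0) refl a₁ a₂) (y₁² y₁-shape 2F))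

      y₁≡0 : Zero (q 4F)
      y₁≡0 0F = start₄
      y₁≡0 1F = a₁≡0
      -- The coefficient of s²t⁴ in y₁² is a₂² only once a₁ = 0 removes the cross terms with a₃.
      y₁≡0 2F = x*x≡0⇒x≡0 (trans (solve 2 (λ a₂ a₃ → a₂ :* a₂ := :0 :* a₃ :+ a₂ :* a₂ :+ a₃ :* :0) refl a₂ a₃)
        (y₁² {cubic 0# 0# a₂ a₃} (cubic-η start₄ a₁≡0 refl refl) 4F))
      y₁≡0 3F = x*x≡0⇒x≡0 (y₁² y₁-shape 6F)

      x₁≡0 : Zero (q 1F)
      x₁≡0 = product≡0⇒zero start λ j → trans (x₁y₀≡x₀y₁ j) (product-zeroʳ (q 0F) y₁≡0 j)

      x₂≡0 : Zero (q 2F)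
      x₂≡0 = product≡0⇒zero start λ j → trans (x₂y₀≡x₁y₁ j) (product-zeroʳ (q 1F) y₁≡0 j)

    module Generic (c≢0 : c ≢ 0#) where

      -- Y₂ = c t² (f₀ s + f₁ t), and the other coordinates follow by dividing the quadrics by t.
      c⁻¹ f₀ f₁ : Carrier
      c⁻¹ = proj₁ (inverse c c≢0)
      f₀ = c⁻¹ * b₂
      f₁ = c⁻¹ * b₃

      c*[c⁻¹*x] : ∀ x → c * (c⁻¹ * x) ≡ x
      c*[c⁻¹*x] x = trans (sym (*-assoc c c⁻¹ x)) (trans (cong (_* x) (proj₂ (inverse c c≢0))) (*-identityˡ x))

      y₂-form : q 5F ≗ cubic 0# 0# (c * f₀) (c * f₁)
      y₂-form = cubic-η start₅ b₁≡0 (sym (c*[c⁻¹*x] b₂)) (sym (c*[c⁻¹*x] b₃))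

      -- Multiplication by y₃ = c t³ moves coefficients up by three places, so in every use j is i +
      -- 3: `lhs` expresses this shift and `rhs` gives the value on the other side of the quadric.
      divide : ∀ {r u} p → product p (q 6F) ≗ product r u → ∀ r′ u′ → r ≗ r′ → u ≗ u′ → ∀ i j {x} →
        product p (cubic 0# 0# 0# c) j ≡ c * p i → product r′ u′ j ≡ c * x → p i ≡ x
      divide p e r′ u′ er eu i j lhs rhs = *-cancelˡ c≢0 (trans (sym lhs) (trans
        (sym (product-cong {p} (λ _ → refl) y₃-shape j)) (trans (e j) (trans (product-cong er eu j) rhs))))

      times-c-3F : ∀ p → product p (cubic 0# 0# 0# c) 3F ≡ c * p 0F
      times-c-3F p = solve 5 (λ c p₀ p₁ p₂ p₃ → p₀ :* c :+ p₁ :* :0 :+ p₂ :* :0 :+ p₃ :* :0 := c :* p₀) refl c (p 0F) (p 1F) (p 2F) (p 3F)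

      times-c-4F : ∀ p → product p (cubic 0# 0# 0# c) 4F ≡ c * p 1F
      times-c-4F p = solve 4 (λ c p₁ p₂ p₃ → p₁ :* c :+ p₂ :* :0 :+ p₃ :* :0 := c :* p₁) refl c (p 1F) (p 2F) (p 3F)

      times-c-5F : ∀ p → product p (cubic 0# 0# 0# c) 5F ≡ c * p 2F
      times-c-5F p = solve 3 (λ c p₂ p₃ → p₂ :* c :+ p₃ :* :0 := c :* p₂) refl c (p 2F) (p 3F)

      times-c-6F : ∀ p → product p (cubic 0# 0# 0# c) 6F ≡ c * p 3F
      times-c-6F p = *-comm (p 3F) c

      -- With f = f₀ s + f₁ t, this is c f² t, and `Y₀` below is c f³. The binomial coefficients are
      -- written as repeated sums.
      Y₁ : Cubic
      Y₁ = cubic 0# (c * (f₀ * f₀)) (c * (f₀ * f₁ + f₀ * f₁)) (c * (f₁ * f₁))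

      y₁-form : q 4F ≗ Y₁
      y₁-form = cubic-η start₄
        (quotient-of 1F 4F (times-c-4F (q 4F)) (solve 3 (λ c f₀ f₁ → :0 :* (c :* f₁) :+ c :* f₀ :* (c :* f₀) :+ c :* f₁ :* :0 := c :* (c :* (f₀ :* f₀))) refl c f₀ f₁))
        (quotient-of 2F 5F (times-c-5F (q 4F)) (solve 3 (λ c f₀ f₁ → c :* f₀ :* (c :* f₁) :+ c :* f₁ :* (c :* f₀) := c :* (c :* (f₀ :* f₁ :+ f₀ :* f₁))) refl c f₀ f₁))
        (quotient-of 3F 6F (times-c-6F (q 4F)) (solve 2 (λ c f₁ → c :* f₁ :* (c :* f₁) := c :* (c :* (f₁ :* f₁))) refl c f₁))
        where
        quotient-of = divide (q 4F) y₁y₃≡y₂y₂ (cubic 0# 0# (c * f₀) (c * f₁)) (cubic 0# 0# (c * f₀) (c * f₁)) y₂-form y₂-form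

      Y₀ : Cubic
      Y₀ = cubic (c * (f₀ * f₀ * f₀)) (c * (f₀ * f₀ * f₁ + f₀ * f₀ * f₁ + f₀ * f₀ * f₁)) (c * (f₀ * f₁ * f₁ + f₀ * f₁ * f₁ + f₀ * f₁ * f₁)) (c * (f₁ * f₁ * f₁))

      y₀-form : q 3F ≗ Y₀
      y₀-form = cubic-η
        (quotient-of 0F 3F (times-c-3F (q 3F)) (solve 3 (λ c f₀ f₁ → let a₁ = c :* (f₀ :* f₀) ; a₂ = c :* (f₀ :* f₁ :+ f₀ :* f₁) ; a₃ = c :* (f₁ :* f₁) in
          :0 :* (c :* f₁) :+ a₁ :* (c :* f₀) :+ a₂ :* :0 :+ a₃ :* :0 := c :* (c :* (f₀ :* f₀ :* f₀))) refl c f₀ f₁))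
        (quotient-of 1F 4F (times-c-4F (q 3F)) (solve 3 (λ c f₀ f₁ → let a₁ = c :* (f₀ :* f₀) ; a₂ = c :* (f₀ :* f₁ :+ f₀ :* f₁) ; a₃ = c :* (f₁ :* f₁) in
          a₁ :* (c :* f₁) :+ a₂ :* (c :* f₀) :+ a₃ :* :0 := c :* (c :* (f₀ :* f₀ :* f₁ :+ f₀ :* f₀ :* f₁ :+ f₀ :* f₀ :* f₁))) refl c f₀ f₁))
        (quotient-of 2F 5F (times-c-5F (q 3F)) (solve 3 (λ c f₀ f₁ → let a₂ = c :* (f₀ :* f₁ :+ f₀ :* f₁) ; a₃ = c :* (f₁ :* f₁) in
          a₂ :* (c :* f₁) :+ a₃ :* (c :* f₀) := c :* (c :* (f₀ :* f₁ :* f₁ :+ f₀ :* f₁ :* f₁ :+ f₀ :* f₁ :* f₁))) refl c f₀ f₁))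
        (quotient-of 3F 6F (times-c-6F (q 3F)) (solve 2 (λ c f₁ → c :* (f₁ :* f₁) :* (c :* f₁) := c :* (c :* (f₁ :* f₁ :* f₁))) refl c f₁))
        where
        quotient-of = divide (q 3F) y₀y₃≡y₁y₂ Y₁ (cubic 0# 0# (c * f₀) (c * f₁)) y₁-form y₂-form

      -- y₀ = c f³ is non-zero at (1,0). This makes (s,t) ↦ (f,t) an invertible change of parameter.
      f₀≢0 : f₀ ≢ 0#
      f₀≢0 f₀≡0 = start (trans (y₀-form 0F) (trans (cong (λ f → c * (f * f * f)) f₀≡0)
        (solve 1 (λ c → c :* (:0 :* :0 :* :0) := :0) refl c)))

      c*f₀≢0 : c * f₀ ≢ 0#
      c*f₀≢0 = *-≢0 c≢0 f₀≢0

      k₀ k₁ : Carrier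
      k₀ = q 2F 2F
      k₁ = q 2F 3F

      private
        -- t³ divides r y₃ = p y₂, while y₂ = c f t² contains t exactly twice, so t divides p.
        lower : ∀ (p : Cubic) {r} → product r (q 6F) ≗ product p (q 5F) → (p 0F ≡ 0#)
        lower p {r} e = *-cancelˡ-≡0 c*f₀≢0 (begin
          c * f₀ * p 0F                                                      ≡⟨ solve 4 (λ x p₀ p₁ p₂ → x :* p₀ := p₀ :* x :+ p₁ :* :0 :+ p₂ :* :0) refl (c * f₀) (p 0F) (p 1F) (p 2F) ⟩
          product p (cubic 0# 0# (c * f₀) (c * f₁)) 2F                        ≡⟨ sym (product-cong {p} (λ _ → refl) y₂-form 2F) ⟩
          product p (q 5F) 2F                                                ≡⟨ sym (e 2F) ⟩
          product r (q 6F) 2F                                                ≡⟨ product-cong {r} (λ _ → refl) y₃-shape 2F ⟩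
          product r (cubic 0# 0# 0# c) 2F                                    ≡⟨ solve 3 (λ r₀ r₁ r₂ → r₀ :* :0 :+ r₁ :* :0 :+ r₂ :* :0 := :0) refl (r 0F) (r 1F) (r 2F) ⟩
          0#                                                                 ∎)
          where open ≡-Reasoning

      x₂₀≡0 : q 2F 0F ≡ 0#
      x₂₀≡0 = lower (q 2F) {q 1F} x₁y₃≡x₂y₂

      x₁₀≡0 : q 1F 0F ≡ 0#
      x₁₀≡0 = lower (q 1F) {q 0F} x₀y₃≡x₁y₂

      -- Now t divides x₁, so t⁴ divides x₁y₃ = x₂y₂, and t² divides x₂.
      x₂₁≡0 : q 2F 1F ≡ 0#
      x₂₁≡0 = *-cancelˡ-≡0 c*f₀≢0 (begin
        c * f₀ * q 2F 1F                                    ≡⟨ solve 5 (λ x y p₁ p₂ p₃ → x :* p₁ := :0 :* y :+ p₁ :* x :+ p₂ :* :0 :+ p₃ :* :0) refl (c * f₀) (c * f₁) (q 2F 1F) k₀ k₁ ⟩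
        product (cubic 0# (q 2F 1F) k₀ k₁) (cubic 0# 0# (c * f₀) (c * f₁)) 3F ≡⟨ sym (product-cong {q 2F} (cubic-η x₂₀≡0 refl refl refl) y₂-form 3F) ⟩
        product (q 2F) (q 5F) 3F                            ≡⟨ sym (x₁y₃≡x₂y₂ 3F) ⟩
        product (q 1F) (q 6F) 3F                            ≡⟨ product-cong {q 1F} (λ _ → refl) y₃-shape 3F ⟩
        product (q 1F) (cubic 0# 0# 0# c) 3F                ≡⟨ times-c-3F (q 1F) ⟩
        c * q 1F 0F                                         ≡⟨ cong (c *_) x₁₀≡0 ⟩
        c * 0#                                              ≡⟨ zeroʳ c ⟩
        0#                                                  ∎)
        where open ≡-Reasoning

      -- The forms k t², k f t and k f² with k = k₀ s + k₁ t, each obtained from the one before by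
      -- replacing a factor t by f.
      X₂ X₁ X₀ : Cubic
      X₂ = cubic 0# 0# k₀ k₁
      X₁ = cubic 0# (k₀ * f₀) (k₀ * f₁ + k₁ * f₀) (k₁ * f₁)
      X₀ = cubic (k₀ * f₀ * f₀) (k₀ * f₀ * f₁ + (k₀ * f₁ + k₁ * f₀) * f₀) ((k₀ * f₁ + k₁ * f₀) * f₁ + k₁ * f₁ * f₀) (k₁ * f₁ * f₁)

      x₂-form : q 2F ≗ X₂
      x₂-form = cubic-η x₂₀≡0 x₂₁≡0 refl refl

      x₁-form : q 1F ≗ X₁
      x₁-form = cubic-η x₁₀≡0
        (quotient-of 1F 4F (times-c-4F (q 1F)) (solve 5 (λ c f₀ f₁ k₀ k₁ → :0 :* (c :* f₁) :+ k₀ :* (c :* f₀) :+ k₁ :* :0 := c :* (k₀ :* f₀)) refl c f₀ f₁ k₀ k₁))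
        (quotient-of 2F 5F (times-c-5F (q 1F)) (solve 5 (λ c f₀ f₁ k₀ k₁ → k₀ :* (c :* f₁) :+ k₁ :* (c :* f₀) := c :* (k₀ :* f₁ :+ k₁ :* f₀)) refl c f₀ f₁ k₀ k₁))
        (quotient-of 3F 6F (times-c-6F (q 1F)) (solve 3 (λ c f₁ k₁ → k₁ :* (c :* f₁) := c :* (k₁ :* f₁)) refl c f₁ k₁))
        where
        quotient-of = divide (q 1F) x₁y₃≡x₂y₂ X₂ (cubic 0# 0# (c * f₀) (c * f₁)) x₂-form y₂-form

      x₀-form : q 0F ≗ X₀
      x₀-form = cubic-η
        (quotient-of 0F 3F (times-c-3F (q 0F)) (solve 6 (λ c f₀ f₁ p q r → :0 :* (c :* f₁) :+ p :* (c :* f₀) :+ q :* :0 :+ r :* :0 := c :* (p :* f₀)) refl c f₀ f₁ p₁ p₂ p₃))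
        (quotient-of 1F 4F (times-c-4F (q 0F)) (solve 6 (λ c f₀ f₁ p q r → p :* (c :* f₁) :+ q :* (c :* f₀) :+ r :* :0 := c :* (p :* f₁ :+ q :* f₀)) refl c f₀ f₁ p₁ p₂ p₃))
        (quotient-of 2F 5F (times-c-5F (q 0F)) (solve 6 (λ c f₀ f₁ p q r → q :* (c :* f₁) :+ r :* (c :* f₀) := c :* (q :* f₁ :+ r :* f₀)) refl c f₀ f₁ p₁ p₂ p₃))
        (quotient-of 3F 6F (times-c-6F (q 0F)) (solve 3 (λ c f₁ r → r :* (c :* f₁) := c :* (r :* f₁)) refl c f₁ p₃))
        where
        p₁ = X₁ 1F
        p₂ = X₁ 2F
        p₃ = X₁ 3F
        quotient-of = divide (q 0F) x₀y₃≡x₁y₂ X₁ (cubic 0# 0# (c * f₀) (c * f₁)) x₁-form y₂-form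

      parametrisation : ∀ s t i → form (q i) s t ≡ conic+cubic (k₀ * s + k₁ * t) c (f₀ * s + f₁ * t) t (f₀ * s + f₁ * t) t i
      parametrisation s t = λ where
          0F → trans (∙-cong {monomials s t} (λ _ → refl) x₀-form)
            (solve 7 (λ c f₀ f₁ k₀ k₁ s t → :form (k₀ :* f₀ :* f₀) (k₀ :* f₀ :* f₁ :+ (k₀ :* f₁ :+ k₁ :* f₀) :* f₀) ((k₀ :* f₁ :+ k₁ :* f₀) :* f₁ :+ k₁ :* f₁ :* f₀) (k₁ :* f₁ :* f₁) s t
              := :point c f₀ f₁ k₀ k₁ s t 0F) refl c f₀ f₁ k₀ k₁ s t)
          1F → trans (∙-cong {monomials s t} (λ _ → refl) x₁-form)
            (solve 7 (λ c f₀ f₁ k₀ k₁ s t → :form :0 (k₀ :* f₀) (k₀ :* f₁ :+ k₁ :* f₀) (k₁ :* f₁) s t := :point c f₀ f₁ k₀ k₁ s t 1F) refl c f₀ f₁ k₀ k₁ s t)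
          2F → trans (∙-cong {monomials s t} (λ _ → refl) x₂-form)
            (solve 7 (λ c f₀ f₁ k₀ k₁ s t → :form :0 :0 k₀ k₁ s t := :point c f₀ f₁ k₀ k₁ s t 2F) refl c f₀ f₁ k₀ k₁ s t)
          3F → trans (∙-cong {monomials s t} (λ _ → refl) y₀-form)
            (solve 7 (λ c f₀ f₁ k₀ k₁ s t → :form (c :* (f₀ :* f₀ :* f₀)) (c :* (f₀ :* f₀ :* f₁ :+ f₀ :* f₀ :* f₁ :+ f₀ :* f₀ :* f₁))
              (c :* (f₀ :* f₁ :* f₁ :+ f₀ :* f₁ :* f₁ :+ f₀ :* f₁ :* f₁)) (c :* (f₁ :* f₁ :* f₁)) s t := :point c f₀ f₁ k₀ k₁ s t 3F) refl c f₀ f₁ k₀ k₁ s t)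
          4F → trans (∙-cong {monomials s t} (λ _ → refl) y₁-form)
            (solve 7 (λ c f₀ f₁ k₀ k₁ s t → :form :0 (c :* (f₀ :* f₀)) (c :* (f₀ :* f₁ :+ f₀ :* f₁)) (c :* (f₁ :* f₁)) s t := :point c f₀ f₁ k₀ k₁ s t 4F) refl c f₀ f₁ k₀ k₁ s t)
          5F → trans (∙-cong {monomials s t} (λ _ → refl) y₂-form)
            (solve 7 (λ c f₀ f₁ k₀ k₁ s t → :form :0 :0 (c :* f₀) (c :* f₁) s t := :point c f₀ f₁ k₀ k₁ s t 5F) refl c f₀ f₁ k₀ k₁ s t)
          6F → trans (∙-cong {monomials s t} (λ _ → refl) y₃-shape)
            (solve 7 (λ c f₀ f₁ k₀ k₁ s t → :form :0 :0 :0 c s t := :point c f₀ f₁ k₀ k₁ s t 6F) refl c f₀ f₁ k₀ k₁ s t)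
        where
        :point : ∀ {n} (c f₀ f₁ k₀ k₁ s t : Polynomial n) → Fin 7 → Polynomial n
        :point c f₀ f₁ k₀ k₁ s t = let f = f₀ :* s :+ f₁ :* t in :conic+cubic (k₀ :* s :+ k₁ :* t) c f t f t

    -- Only x₀ and y₀ survive: the curve lies on the generator of (1,0).
    Collapsed : Set
    Collapsed = Zero (q 1F) × Zero (q 2F) × Zero (q 4F) × Zero (q 5F) × Zero (q 6F)

    Parametrised : Set
    Parametrised = ∃[ c ] ∃[ f₀ ] ∃[ f₁ ] ∃[ k₀ ] ∃[ k₁ ] (c ≢ 0# × f₀ ≢ 0# ×
      (∀ s t i → form (q i) s t ≡ conic+cubic (k₀ * s + k₁ * t) c (f₀ * s + f₁ * t) t (f₀ * s + f₁ * t) t i))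

    classification : Collapsed ⊎ Parametrised
    classification with c ≟ 0#
    ... | yes c≡0 = let open Degenerate c≡0 in inj₁ (x₁≡0 , x₂≡0 , y₁≡0 , y₂≡0 , y₃≡0)
    ... | no c≢0  = let open Generic c≢0 in inj₂ (c , f₀ , f₁ , k₀ , k₁ , c≢0 , f₀≢0 , parametrisation)

  -- The symmetric cube of a 2×2 matrix

  -- Coefficients of the product of the linear forms l₁ s + l₂ t, m₁ s + m₂ t and n₁ s + n₂ t.
  cubeOf : (l₁ l₂ m₁ m₂ n₁ n₂ : Carrier) → Cubic
  cubeOf l₁ l₂ m₁ m₂ n₁ n₂ = cubic (l₁ * m₁ * n₁) (l₁ * m₁ * n₂ + l₁ * m₂ * n₁ + l₂ * m₁ * n₁)
    (l₁ * m₂ * n₂ + l₂ * m₁ * n₂ + l₂ * m₂ * n₁) (l₂ * m₂ * n₂)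

  :blossom : ∀ {n} (y₀ y₁ y₂ y₃ l₁ l₂ m₁ m₂ n₁ n₂ : Polynomial n) → Polynomial n
  :blossom y₀ y₁ y₂ y₃ l₁ l₂ m₁ m₂ n₁ n₂ = y₀ :* (l₁ :* m₁ :* n₁) :+ y₁ :* (l₁ :* m₁ :* n₂ :+ l₁ :* m₂ :* n₁ :+ l₂ :* m₁ :* n₁)
    :+ y₂ :* (l₁ :* m₂ :* n₂ :+ l₂ :* m₁ :* n₂ :+ l₂ :* m₂ :* n₁) :+ y₃ :* (l₂ :* m₂ :* n₂)

  module SymmetricCube (l₁ l₂ m₁ m₂ : Carrier) where

    row : Fin 4 → Cubic
    row 0F = cubeOf l₁ l₂ l₁ l₂ l₁ l₂
    row 1F = cubeOf l₁ l₂ l₁ l₂ m₁ m₂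
    row 2F = cubeOf l₁ l₂ m₁ m₂ m₁ m₂
    row 3F = cubeOf m₁ m₂ m₁ m₂ m₁ m₂

    apply : Cubic → Cubic
    apply y i = y ∙ row i

    apply-monomials : ∀ μ s t → apply (λ i → μ * monomials s t i) ≗ λ i → μ * monomials (l₁ * s + l₂ * t) (m₁ * s + m₂ * t) i
    apply-monomials μ s t = λ where
        0F → solve 5 (λ μ s t l₁ l₂ → let l = l₁ :* s :+ l₂ :* t in :apply μ s t l₁ l₂ l₁ l₂ l₁ l₂ := μ :* (l :* l :* l)) refl μ s t l₁ l₂
        1F → solve 7 (λ μ s t l₁ l₂ m₁ m₂ → let l = l₁ :* s :+ l₂ :* t ; m = m₁ :* s :+ m₂ :* t in :apply μ s t l₁ l₂ l₁ l₂ m₁ m₂ := μ :* (l :* l :* m)) refl μ s t l₁ l₂ m₁ m₂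
        2F → solve 7 (λ μ s t l₁ l₂ m₁ m₂ → let l = l₁ :* s :+ l₂ :* t ; m = m₁ :* s :+ m₂ :* t in :apply μ s t l₁ l₂ m₁ m₂ m₁ m₂ := μ :* (l :* m :* m)) refl μ s t l₁ l₂ m₁ m₂
        3F → solve 5 (λ μ s t m₁ m₂ → let m = m₁ :* s :+ m₂ :* t in :apply μ s t m₁ m₂ m₁ m₂ m₁ m₂ := μ :* (m :* m :* m)) refl μ s t m₁ m₂
      where
      :apply : ∀ {n} (μ s t l₁ l₂ m₁ m₂ n₁ n₂ : Polynomial n) → Polynomial n
      :apply μ s t = :blossom (μ :* (s :* s :* s)) (μ :* (s :* s :* t)) (μ :* (s :* t :* t)) (μ :* (t :* t :* t))

  module _ (l₁ l₂ m₁ m₂ : Carrier) where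
    open SymmetricCube l₁ l₂ m₁ m₂
    private module Adjugate = SymmetricCube m₂ (- l₂) (- m₁) l₁

    -- Adjugate times matrix is δ times the identity, and symmetric powers respect products, so the
    -- composite is the symmetric cube of a scalar matrix. No binomial coefficient is inverted.
    adjugate-apply : ∀ y i → let δ = l₁ * m₂ + - (l₂ * m₁) in Adjugate.apply (apply y) i ≡ δ * δ * δ * y i
    adjugate-apply y = λ where
        0F → solve 8 (λ y₀ y₁ y₂ y₃ l₁ l₂ m₁ m₂ → let δ = l₁ :* m₂ :+ :- (l₂ :* m₁) in :inverse l₁ l₂ m₁ m₂ y₀ y₁ y₂ y₃ m₂ (:- l₂) m₂ (:- l₂) m₂ (:- l₂) := δ :* δ :* δ :* y₀) refl
               (y 0F) (y 1F) (y 2F) (y 3F) l₁ l₂ m₁ m₂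
        1F → solve 8 (λ y₀ y₁ y₂ y₃ l₁ l₂ m₁ m₂ → let δ = l₁ :* m₂ :+ :- (l₂ :* m₁) in :inverse l₁ l₂ m₁ m₂ y₀ y₁ y₂ y₃ m₂ (:- l₂) m₂ (:- l₂) (:- m₁) l₁ := δ :* δ :* δ :* y₁) refl
               (y 0F) (y 1F) (y 2F) (y 3F) l₁ l₂ m₁ m₂
        2F → solve 8 (λ y₀ y₁ y₂ y₃ l₁ l₂ m₁ m₂ → let δ = l₁ :* m₂ :+ :- (l₂ :* m₁) in :inverse l₁ l₂ m₁ m₂ y₀ y₁ y₂ y₃ m₂ (:- l₂) (:- m₁) l₁ (:- m₁) l₁ := δ :* δ :* δ :* y₂) refl
               (y 0F) (y 1F) (y 2F) (y 3F) l₁ l₂ m₁ m₂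
        3F → solve 8 (λ y₀ y₁ y₂ y₃ l₁ l₂ m₁ m₂ → let δ = l₁ :* m₂ :+ :- (l₂ :* m₁) in :inverse l₁ l₂ m₁ m₂ y₀ y₁ y₂ y₃ (:- m₁) l₁ (:- m₁) l₁ (:- m₁) l₁ := δ :* δ :* δ :* y₃) refl
               (y 0F) (y 1F) (y 2F) (y 3F) l₁ l₂ m₁ m₂
      where
      :inverse : ∀ {n} (l₁ l₂ m₁ m₂ y₀ y₁ y₂ y₃ l₁′ l₂′ m₁′ m₂′ n₁′ n₂′ : Polynomial n) → Polynomial n
      :inverse l₁ l₂ m₁ m₂ y₀ y₁ y₂ y₃ = :blossom (B l₁ l₂ l₁ l₂ l₁ l₂) (B l₁ l₂ l₁ l₂ m₁ m₂) (B l₁ l₂ m₁ m₂ m₁ m₂) (B m₁ m₂ m₁ m₂ m₁ m₂)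
        where B = :blossom y₀ y₁ y₂ y₃

    apply-injective : l₁ * m₂ + - (l₂ * m₁) ≢ 0# → ∀ {y z} → apply y ≗ apply z → y ≗ z
    apply-injective δ≢0 {y} {z} e i = *-cancelˡ (*-≢0 (*-≢0 δ≢0 δ≢0) δ≢0) (begin
      _ * y i                          ≡⟨ sym (adjugate-apply y i) ⟩
      Adjugate.apply (apply y) i       ≡⟨ ∙-cong {q = Adjugate.row i} e (λ _ → refl) ⟩
      Adjugate.apply (apply z) i       ≡⟨ adjugate-apply z i ⟩
      _ * z i                          ∎)
      where open ≡-Reasoning

    apply-zero⇒zero : l₁ * m₂ + - (l₂ * m₁) ≢ 0# → ∀ {y} → Zero (apply y) → Zero y
    apply-zero⇒zero δ≢0 {y} e = apply-injective δ≢0 {y} {λ _ → 0#} λ i → trans (e i) (sym (zeros (row i)))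
      where
      zeros : ∀ p → (λ _ → 0#) ∙ p ≡ 0#
      zeros p = solve 4 (λ p₀ p₁ p₂ p₃ → :0 :* p₀ :+ :0 :* p₁ :+ :0 :* p₂ :+ :0 :* p₃ := :0) refl (p 0F) (p 1F) (p 2F) (p 3F)

  -- Projective points and parametrised curves

  x³≡0⇒x≡0 : ∀ {x} → x * x * x ≡ 0# → x ≡ 0#
  x³≡0⇒x≡0 {x} e with x ≟ 0#
  ... | yes x≡0 = x≡0
  ... | no x≢0  = *-cancelˡ-≡0 (*-≢0 x≢0 x≢0) e

  ∼-trans : ∀ {u v w} → u ∼ v → v ∼ w → u ∼ w
  ∼-trans (c , c≢0 , e) (d , d≢0 , f) = c * d , *-≢0 c≢0 d≢0 , λ i → trans (e i) (trans (cong (c *_) (f i)) (sym (*-assoc c d _)))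

  ∼-sym : ∀ {u v} → u ∼ v → v ∼ u
  ∼-sym {u} {v} (c , c≢0 , e) with inverse c c≢0
  ... | c⁻¹ , cc⁻¹≡1 = c⁻¹ , c⁻¹≢0 , λ i → *-cancelˡ c≢0 (begin
      c * v i            ≡⟨ sym (e i) ⟩
      u i                ≡⟨ sym (*-identityˡ (u i)) ⟩
      1# * u i           ≡⟨ cong (_* u i) (sym cc⁻¹≡1) ⟩
      c * c⁻¹ * u i      ≡⟨ *-assoc c c⁻¹ (u i) ⟩
      c * (c⁻¹ * u i)    ∎)
    where
    open ≡-Reasoning
    c⁻¹≢0 : c⁻¹ ≢ 0#
    c⁻¹≢0 c⁻¹≡0 = 0≢1 (trans (sym (zeroʳ c)) (trans (cong (c *_) (sym c⁻¹≡0)) cc⁻¹≡1))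

  ≗⇒∼ : ∀ {u v : Vec7} → u ≗ v → u ∼ v
  ≗⇒∼ e = 1# , 1≢0 , λ i → trans (e i) (sym (*-identityˡ _))

  -- Homogeneous parameters let linear substitutions act without singling out the parameter ∞.
  Curve : (Carrier → Carrier → Vec7) → PointSet
  Curve P w = ∃[ s ] ∃[ t ] (ParamOK s t × w ∼ P s t)

  Curve-mono : ∀ {P Q} → (∀ s t → ParamOK s t → Curve Q (P s t)) → ∀ {w} → Curve P w → Curve Q w
  Curve-mono P⊆Q (s , t , ok , w∼P) with P⊆Q s t ok
  ... | s′ , t′ , ok′ , P∼Q = s′ , t′ , ok′ , ∼-trans w∼P P∼Q

  point : (Fin 4 → Vec7) → Carrier → Carrier → Vec7
  point a s t = comb (monomials s t) a

  AffineCubic : (Fin 4 → Vec7) → PointSet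
  AffineCubic a w = (∃[ t ] (w ∼ cubicPt a t)) ⊎ (w ∼ a 3F)

  affine⇒Curve : ∀ a {w} → AffineCubic a w → Curve (point a) w
  affine⇒Curve a (inj₁ (t , w∼)) = 1# , t , 1-x-ok , ∼-trans w∼ (≗⇒∼ λ i →
    solve 5 (λ t a₀ a₁ a₂ a₃ → :1 :* a₀ :+ t :* a₁ :+ t :* t :* a₂ :+ t :* t :* t :* a₃ := :form a₀ a₁ a₂ a₃ :1 t) refl t (a 0F i) (a 1F i) (a 2F i) (a 3F i))
  affine⇒Curve a (inj₂ w∼) = 0# , 1# , x-1-ok , ∼-trans w∼ (≗⇒∼ λ i → sym (form-∞ (λ k → a k i)))

  Curve⇒affine : ∀ a {w} → Curve (point a) w → AffineCubic a w
  Curve⇒affine a (s , t , ok , w∼) with s ≟ 0#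
  ... | yes refl = inj₂ (∼-trans w∼ (t * t * t , (λ e → ok (refl , x³≡0⇒x≡0 e)) , λ i →
    solve 5 (λ t a₀ a₁ a₂ a₃ → :form a₀ a₁ a₂ a₃ :0 t := t :* t :* t :* a₃) refl t (a 0F i) (a 1F i) (a 2F i) (a 3F i)))
  ... | no s≢0 = inj₁ (r , ∼-trans w∼ (s * s * s , (λ e → s≢0 (x³≡0⇒x≡0 e)) , λ i → begin
      form (λ k → a k i) s t         ≡⟨ cong (form (λ k → a k i) s) t≡sr ⟩
      form (λ k → a k i) s (s * r)   ≡⟨ solve 6 (λ s r a₀ a₁ a₂ a₃ → :form a₀ a₁ a₂ a₃ s (s :* r) := s :* s :* s :* (:1 :* a₀ :+ r :* a₁ :+ r :* r :* a₂ :+ r :* r :* r :* a₃)) refl s r (a 0F i) (a 1F i) (a 2F i) (a 3F i) ⟩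
      s * s * s * cubicPt a r i      ∎))
    where
    open ≡-Reasoning
    s⁻¹ = proj₁ (inverse s s≢0)
    r = s⁻¹ * t
    t≡sr : t ≡ s * r
    t≡sr = sym (trans (sym (*-assoc s s⁻¹ t)) (trans (cong (_* t) (proj₂ (inverse s s≢0))) (*-identityˡ t)))

  point-nonzero : ∀ {a} → LinIndep4 a → ∀ {s t} → ParamOK s t → NonZero (point a s t)
  point-nonzero indep {s} {t} ok e = ok (x³≡0⇒x≡0 (indep (monomials s t) e 0F) , x³≡0⇒x≡0 (indep (monomials s t) e 3F))

  conic+cubic-·-homogeneous : ∀ κ λ′ μ s t σ τ i → conic+cubic (κ * λ′) (κ * μ) s t σ τ i ≡ κ * conic+cubic λ′ μ s t σ τ i
  conic+cubic-·-homogeneous κ λ′ μ s t σ τ i = solve 5 (λ κ λ′ μ x y → κ :* λ′ :* x :+ κ :* μ :* y := κ :* (λ′ :* x :+ μ :* y)) refl κ λ′ μ (conicPt s t i) (twcPt σ τ i)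

  nonzero-coordinate : ∀ {s t} {A : Set} → ParamOK s t → (s ≢ 0# → A) → (t ≢ 0# → A) → A
  nonzero-coordinate {s} {t} ok f g with s ≟ 0# | t ≟ 0#
  ... | no s≢0   | _        = f s≢0
  ... | yes _    | no t≢0   = g t≢0
  ... | yes s≡0  | yes t≡0  = contradiction (s≡0 , t≡0) ok

  -- The pair found completes (s,t) to a matrix of determinant 1. It serves to extract factors of
  -- proportionality and to move a given generator to (1,0).
  bézout : ∀ {s t} → ParamOK s t → ∃[ x ] ∃[ y ] (x * s + y * t ≡ 1#)
  bézout {s} {t} ok = nonzero-coordinate ok
    (λ s≢0 → let s⁻¹ , ss⁻¹≡1 = inverse s s≢0 in
      s⁻¹ , 0# , trans (solve 3 (λ s t s⁻¹ → s⁻¹ :* s :+ :0 :* t := s :* s⁻¹) refl s t s⁻¹) ss⁻¹≡1)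
    (λ t≢0 → let t⁻¹ , tt⁻¹≡1 = inverse t t≢0 in
      0# , t⁻¹ , trans (solve 3 (λ s t t⁻¹ → :0 :* s :+ t⁻¹ :* t := t :* t⁻¹) refl s t t⁻¹) tt⁻¹≡1)

  scaled-ok : ∀ {ρ s t s′ t′} → ParamOK s t → s ≡ ρ * s′ → t ≡ ρ * t′ → ρ ≢ 0# × ParamOK s′ t′
  scaled-ok {ρ} {s′ = s′} {t′} ok refl refl =
    (λ { refl → ok (zeroˡ s′ , zeroˡ t′) }) , λ { (refl , refl) → ok (zeroʳ ρ , zeroʳ ρ) }

  proportional : ∀ {μ μ′ s t s′ t′} → μ ≢ 0# → ParamOK s t → ParamOK s′ t′ →
    (∀ i → μ * monomials s t i ≡ μ′ * monomials s′ t′ i) → ∃[ ρ ] ((s ≡ ρ * s′) × (t ≡ ρ * t′))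
  proportional {μ} {μ′} {s} {t} {s′} {t′} μ≢0 ok ok′ e with bézout ok′
  -- If (s,t) = ρ (s′,t′), then x s + y t = ρ (x s′ + y t′) = ρ.
  ... | x , y , xs′+yt′≡1 = x * s + y * t , s≡ , t≡
    where
    open ≡-Reasoning

    cross : s′ * t ≡ s * t′
    -- The ratio s : t is read off the first two monomials if s ≠ 0 and off the last two if t ≠ 0.
    cross = nonzero-coordinate ok
      (λ s≢0 → *-cancelˡ (*-≢0 μ≢0 (*-≢0 s≢0 s≢0)) (begin
        μ * (s * s) * (s′ * t)          ≡⟨ solve 4 (λ μ s s′ t → μ :* (s :* s) :* (s′ :* t) := μ :* (s :* s :* t) :* s′) refl μ s s′ t ⟩
        μ * (s * s * t) * s′            ≡⟨ cong (_* s′) (e 1F) ⟩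
        μ′ * (s′ * s′ * t′) * s′        ≡⟨ solve 3 (λ μ′ s′ t′ → μ′ :* (s′ :* s′ :* t′) :* s′ := μ′ :* (s′ :* s′ :* s′) :* t′) refl μ′ s′ t′ ⟩
        μ′ * (s′ * s′ * s′) * t′        ≡⟨ cong (_* t′) (sym (e 0F)) ⟩
        μ * (s * s * s) * t′            ≡⟨ solve 3 (λ μ s t′ → μ :* (s :* s :* s) :* t′ := μ :* (s :* s) :* (s :* t′)) refl μ s t′ ⟩
        μ * (s * s) * (s * t′)          ∎))
      (λ t≢0 → *-cancelˡ (*-≢0 μ≢0 (*-≢0 t≢0 t≢0)) (begin
        μ * (t * t) * (s′ * t)          ≡⟨ solve 3 (λ μ s′ t → μ :* (t :* t) :* (s′ :* t) := μ :* (t :* t :* t) :* s′) refl μ s′ t ⟩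
        μ * (t * t * t) * s′            ≡⟨ cong (_* s′) (e 3F) ⟩
        μ′ * (t′ * t′ * t′) * s′        ≡⟨ solve 3 (λ μ′ s′ t′ → μ′ :* (t′ :* t′ :* t′) :* s′ := μ′ :* (s′ :* t′ :* t′) :* t′) refl μ′ s′ t′ ⟩
        μ′ * (s′ * t′ * t′) * t′        ≡⟨ cong (_* t′) (sym (e 2F)) ⟩
        μ * (s * t * t) * t′            ≡⟨ solve 4 (λ μ s t t′ → μ :* (s :* t :* t) :* t′ := μ :* (t :* t) :* (s :* t′)) refl μ s t t′ ⟩
        μ * (t * t) * (s * t′)          ∎))

    s≡ : s ≡ (x * s + y * t) * s′
    s≡ = begin
      s                               ≡⟨ sym (*-identityʳ s) ⟩
      s * 1#                          ≡⟨ cong (s *_) (sym xs′+yt′≡1) ⟩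
      s * (x * s′ + y * t′)           ≡⟨ solve 5 (λ s x s′ y t′ → s :* (x :* s′ :+ y :* t′) := x :* s :* s′ :+ y :* (s :* t′)) refl s x s′ y t′ ⟩
      x * s * s′ + y * (s * t′)       ≡⟨ cong (λ z → x * s * s′ + y * z) (sym cross) ⟩
      x * s * s′ + y * (s′ * t)       ≡⟨ solve 5 (λ s x s′ y t → x :* s :* s′ :+ y :* (s′ :* t) := (x :* s :+ y :* t) :* s′) refl s x s′ y t ⟩
      (x * s + y * t) * s′            ∎

    t≡ : t ≡ (x * s + y * t) * t′
    t≡ = begin
      t                               ≡⟨ sym (*-identityʳ t) ⟩
      t * 1#                          ≡⟨ cong (t *_) (sym xs′+yt′≡1) ⟩
      t * (x * s′ + y * t′)           ≡⟨ solve 5 (λ t x s′ y t′ → t :* (x :* s′ :+ y :* t′) := x :* (s′ :* t) :+ y :* t :* t′) refl t x s′ y t′ ⟩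
      x * (s′ * t) + y * t * t′       ≡⟨ cong (λ z → x * z + y * t * t′) cross ⟩
      x * (s * t′) + y * t * t′       ≡⟨ solve 5 (λ s x t′ y t → x :* (s :* t′) :+ y :* t :* t′ := (x :* s :+ y :* t) :* t′) refl s x t′ y t ⟩
      (x * s + y * t) * t′            ∎

  twcPart : Vec7 → Cubic
  twcPart w i = w (suc (suc (suc i)))

  twcPart-conic+cubic : ∀ λ′ μ s t σ τ → twcPart (conic+cubic λ′ μ s t σ τ) ≗ λ i → μ * monomials σ τ i
  twcPart-conic+cubic λ′ μ s t σ τ = λ where
      0F → drop (σ * σ * σ)
      1F → drop (σ * σ * τ)
      2F → drop (σ * τ * τ)
      3F → drop (τ * τ * τ)
    where
    drop : ∀ z → λ′ * 0# + μ * z ≡ μ * z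
    drop z = solve 3 (λ λ′ μ z → λ′ :* :0 :+ μ :* z := μ :* z) refl λ′ μ z

  -- The q² curves given by linear forms

  module OnSurface (φ : PGL2) where
    open PGL2 φ using (det≢0) renaming (a to φ₁₁; b to φ₁₂; c to φ₂₁; d to φ₂₂)
    open Surface φ
    open SymmetricCube φ₁₁ φ₁₂ φ₂₁ φ₂₂ using (row; apply; apply-monomials)

    generatorPoint : (λ′ μ s t : Carrier) → Vec7
    generatorPoint λ′ μ s t = conic+cubic λ′ μ s t (φ₁₁ * s + φ₁₂ * t) (φ₂₁ * s + φ₂₂ * t)

    directrixPoint : (u v s t : Carrier) → Vec7
    directrixPoint u v s t = generatorPoint (u * s + v * t) 1# s t

    directrix : Carrier → Carrier → PointSet
    directrix u v = Curve (directrixPoint u v)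

    -- Column k holds the coefficients of the k-th cubic monomial in `directrixPoint u v`: those of
    -- (u s + v t)(s², st, t²) on top and the symmetric cube of φ below.
    frame : Carrier → Carrier → Fin 4 → Vec7
    frame u v k 0F = cubic u v 0# 0# k
    frame u v k 1F = cubic 0# u v 0# k
    frame u v k 2F = cubic 0# 0# u v k
    frame u v k (suc (suc (suc i))) = row i k

    -- As φ is invertible and μ ≠ 0, the cubic part alone determines the ratio s : t. The weights ρ²
    -- and ρ³ are the degrees of conic and cubic.
    generator-unique : ∀ {λ′ μ s t λ″ μ′ s′ t′} → μ ≢ 0# → ParamOK s t → ParamOK s′ t′ →
      generatorPoint λ′ μ s t ≗ generatorPoint λ″ μ′ s′ t′ →
      ∃[ ρ ] (ρ ≢ 0# × (s ≡ ρ * s′) × (t ≡ ρ * t′) × (λ′ * (ρ * ρ) ≡ λ″) × (μ * (ρ * ρ * ρ) ≡ μ′))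
    generator-unique {λ′} {μ} {s} {t} {λ″} {μ′} {s′} {t′} μ≢0 ok ok′ e = conclude (proportional μ≢0 ok ok′ cubes)
      where
      cubes : ∀ i → μ * monomials s t i ≡ μ′ * monomials s′ t′ i
      cubes = apply-injective φ₁₁ φ₁₂ φ₂₁ φ₂₂ det≢0 {λ i → μ * monomials s t i} {λ i → μ′ * monomials s′ t′ i} λ i →
        trans (apply-monomials μ s t i) (trans (sym (twcPart-conic+cubic λ′ μ s t _ _ i)) (trans (e (suc (suc (suc i))))
          (trans (twcPart-conic+cubic λ″ μ′ s′ t′ _ _ i) (sym (apply-monomials μ′ s′ t′ i)))))

      squares : ∀ ρ x → x ≢ 0# → λ′ * (ρ * x * (ρ * x)) + μ * 0# ≡ λ″ * (x * x) + μ′ * 0# → λ′ * (ρ * ρ) ≡ λ″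
      squares ρ x x≢0 e = *-cancelˡ (*-≢0 x≢0 x≢0)
        (trans (solve 4 (λ λ′ ρ x μ → x :* x :* (λ′ :* (ρ :* ρ)) := λ′ :* (ρ :* x :* (ρ :* x)) :+ μ :* :0) refl λ′ ρ x μ)
        (trans e (solve 3 (λ λ″ x μ′ → λ″ :* (x :* x) :+ μ′ :* :0 := x :* x :* λ″) refl λ″ x μ′)))

      cube : ∀ ρ x → x ≢ 0# → μ * (ρ * x * (ρ * x) * (ρ * x)) ≡ μ′ * (x * x * x) → μ * (ρ * ρ * ρ) ≡ μ′
      cube ρ x x≢0 e = *-cancelˡ (*-≢0 (*-≢0 x≢0 x≢0) x≢0)
        (trans (solve 3 (λ μ ρ x → x :* x :* x :* (μ :* (ρ :* ρ :* ρ)) := μ :* (ρ :* x :* (ρ :* x) :* (ρ :* x))) refl μ ρ x)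
        (trans e (*-comm μ′ _)))

      conclude : ∃[ ρ ] ((s ≡ ρ * s′) × (t ≡ ρ * t′)) →
        ∃[ ρ ] (ρ ≢ 0# × (s ≡ ρ * s′) × (t ≡ ρ * t′) × (λ′ * (ρ * ρ) ≡ λ″) × (μ * (ρ * ρ * ρ) ≡ μ′))
      conclude (ρ , s≡ , t≡) = ρ , proj₁ (scaled-ok ok s≡ t≡) , s≡ , t≡
        , nonzero-coordinate ok′
            (λ s′≢0 → squares ρ s′ s′≢0 (trans (cong (λ x → λ′ * (x * x) + μ * 0#) (sym s≡)) (e 0F)))
            (λ t′≢0 → squares ρ t′ t′≢0 (trans (cong (λ x → λ′ * (x * x) + μ * 0#) (sym t≡)) (e 2F)))
        , nonzero-coordinate ok′
            (λ s′≢0 → cube ρ s′ s′≢0 (trans (cong (λ x → μ * (x * x * x)) (sym s≡)) (cubes 0F)))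
            (λ t′≢0 → cube ρ t′ t′≢0 (trans (cong (λ x → μ * (x * x * x)) (sym t≡)) (cubes 3F)))

    -- The lower block, the symmetric cube of φ, is already invertible. For the same reason the span
    -- of the frame does not meet α.
    frame-independent : ∀ u v → LinIndep4 (frame u v)
    frame-independent u v c e = apply-zero⇒zero φ₁₁ φ₁₂ φ₂₁ φ₂₂ det≢0 λ i → e (suc (suc (suc i)))

    point-frame : ∀ u v s t → point (frame u v) s t ≗ directrixPoint u v s t
    point-frame u v s t = λ where
        0F → solve 4 (λ u v s t → :form u v :0 :0 s t := (u :* s :+ v :* t) :* (s :* s) :+ :1 :* :0) refl u v s t
        1F → solve 4 (λ u v s t → :form :0 u v :0 s t := (u :* s :+ v :* t) :* (s :* t) :+ :1 :* :0) refl u v s t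
        2F → solve 4 (λ u v s t → :form :0 :0 u v s t := (u :* s :+ v :* t) :* (t :* t) :+ :1 :* :0) refl u v s t
        (suc (suc (suc i))) → begin
          monomials s t ∙ row i                         ≡⟨ ∙-cong {q = row i} (λ j → sym (*-identityˡ (monomials s t j))) (λ _ → refl) ⟩
          apply (λ j → 1# * monomials s t j) i          ≡⟨ apply-monomials 1# s t i ⟩
          1# * monomials _ _ i                          ≡⟨ sym (twcPart-conic+cubic (u * s + v * t) 1# s t _ _ i) ⟩
          twcPart (directrixPoint u v s t) i            ∎
      where open ≡-Reasoning

    directrixPoint-nonzero : ∀ u v {s t} → ParamOK s t → NonZero (directrixPoint u v s t)
    directrixPoint-nonzero u v {s} {t} ok e = point-nonzero {frame u v} (frame-independent u v) ok λ i → trans (point-frame u v s t i) (e i)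

    directrix-isTwistedCubic : ∀ u v → IsTwistedCubic (directrix u v)
    directrix-isTwistedCubic u v = frame u v , frame-independent u v , λ w _ →
        (λ w∈ → Curve⇒affine (frame u v) (Curve-mono (λ s t ok → s , t , ok , ≗⇒∼ (λ i → sym (point-frame u v s t i))) w∈))
      , (λ w∈ → Curve-mono (λ s t ok → s , t , ok , ≗⇒∼ (point-frame u v s t)) (affine⇒Curve (frame u v) w∈))

    directrix⊆V : ∀ u v → directrix u v ⊆P V
    directrix⊆V u v w _ (s , t , ok , κ , _ , e) = s , t , ok , κ * (u * s + v * t) , κ * 1# , λ i →
      trans (e i) (sym (conic+cubic-·-homogeneous κ (u * s + v * t) 1# s t _ _ i))

    -- The cubic point has weight 1 on both curves, so points that agree up to κ on a common
    -- generator have κ = ρ³; the linear form has degree 1 and absorbs the factor left over after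
    -- cancelling ρ².
    ⊆directrix⇒same-form : ∀ {u v u′ v′} → directrix u v ⊆P directrix u′ v′ → ∀ {s t} → ParamOK s t → u * s + v * t ≡ u′ * s + v′ * t
    ⊆directrix⇒same-form {u} {v} {u′} {v′} sub {s} {t} ok =
      compare (sub (directrixPoint u v s t) (directrixPoint-nonzero u v ok) (s , t , ok , ≗⇒∼ λ _ → refl))
      where
      compare : directrix u′ v′ (directrixPoint u v s t) → u * s + v * t ≡ u′ * s + v′ * t
      compare (s′ , t′ , ok′ , κ , κ≢0 , e) = conclude (generator-unique 1≢0 ok ok′
          λ i → trans (e i) (sym (conic+cubic-·-homogeneous κ (u′ * s′ + v′ * t′) 1# s′ t′ _ _ i)))
        where
        conclude : ∃[ ρ ] (ρ ≢ 0# × (s ≡ ρ * s′) × (t ≡ ρ * t′) × ((u * s + v * t) * (ρ * ρ) ≡ κ * (u′ * s′ + v′ * t′)) × (1# * (ρ * ρ * ρ) ≡ κ * 1#)) →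
          u * s + v * t ≡ u′ * s + v′ * t
        conclude (ρ , ρ≢0 , s≡ , t≡ , eλ , eμ) = *-cancelˡ (*-≢0 ρ≢0 ρ≢0) (begin
          ρ * ρ * (u * s + v * t)                          ≡⟨ *-comm _ _ ⟩
          (u * s + v * t) * (ρ * ρ)                        ≡⟨ eλ ⟩
          κ * (u′ * s′ + v′ * t′)                          ≡⟨ cong (_* (u′ * s′ + v′ * t′)) (trans (sym (*-identityʳ κ)) (sym eμ)) ⟩
          1# * (ρ * ρ * ρ) * (u′ * s′ + v′ * t′)           ≡⟨ solve 5 (λ ρ u′ s′ v′ t′ → :1 :* (ρ :* ρ :* ρ) :* (u′ :* s′ :+ v′ :* t′) := ρ :* ρ :* (u′ :* (ρ :* s′) :+ v′ :* (ρ :* t′))) refl ρ u′ s′ v′ t′ ⟩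
          ρ * ρ * (u′ * (ρ * s′) + v′ * (ρ * t′))          ≡⟨ cong₂ (λ x y → ρ * ρ * (u′ * x + v′ * y)) (sym s≡) (sym t≡) ⟩
          ρ * ρ * (u′ * s + v′ * t)                        ∎)
          where open ≡-Reasoning

    directrix-injective : ∀ {u v u′ v′} → directrix u v ≐ directrix u′ v′ → (u ≡ u′) × (v ≡ v′)
    directrix-injective {u} {v} {u′} {v′} (sub , _) =
        trans (at-1-0 u v) (trans (⊆directrix⇒same-form {u} {v} sub 1-x-ok) (sym (at-1-0 u′ v′)))
      , trans (at-0-1 u v) (trans (⊆directrix⇒same-form {u} {v} sub x-1-ok) (sym (at-0-1 u′ v′)))
      where
      at-1-0 : ∀ u v → u ≡ u * 1# + v * 0#
      at-1-0 = solve 2 (λ u v → u := u :* :1 :+ v :* :0) refl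
      at-0-1 : ∀ u v → v ≡ u * 0# + v * 1#
      at-0-1 = solve 2 (λ u v → v := u :* :0 :+ v :* :1) refl

    directrixPoint-scale : ∀ u v ρ s t → directrixPoint u v (ρ * s) (ρ * t) ≗ (ρ * ρ * ρ) · directrixPoint u v s t
    directrixPoint-scale u v ρ s t i = begin
      directrixPoint u v (ρ * s) (ρ * t) i                ≡⟨ sym (point-frame u v (ρ * s) (ρ * t) i) ⟩
      point (frame u v) (ρ * s) (ρ * t) i                 ≡⟨ form-scale ρ (λ k → frame u v k i) s t ⟩
      ρ * ρ * ρ * point (frame u v) s t i                 ≡⟨ cong (ρ * ρ * ρ *_) (point-frame u v s t i) ⟩
      ρ * ρ * ρ * directrixPoint u v s t i                ∎
      where open ≡-Reasoning

    on-generator⇒∼ : ∀ {u v s t} → ParamOK s t → ∀ {w} → directrix u v w → Generator s t w → w ∼ directrixPoint u v s t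
    on-generator⇒∼ {u} {v} {s} {t} ok {w} (s′ , t′ , ok′ , κ , κ≢0 , e) (λ′ , μ , g) =
      conclude (generator-unique (*-≢0 κ≢0 1≢0) ok′ ok λ i → trans (conic+cubic-·-homogeneous κ (u * s′ + v * t′) 1# s′ t′ _ _ i) (trans (sym (e i)) (g i)))
      where
      conclude : ∃[ ρ ] (ρ ≢ 0# × (s′ ≡ ρ * s) × (t′ ≡ ρ * t) × (κ * (u * s′ + v * t′) * (ρ * ρ) ≡ λ′) × (κ * 1# * (ρ * ρ * ρ) ≡ μ)) → w ∼ directrixPoint u v s t
      conclude (ρ , ρ≢0 , s′≡ , t′≡ , _) = ∼-trans (κ , κ≢0 , λ i → trans (e i) (cong (κ *_) (cong₂ (λ s t → directrixPoint u v s t i) s′≡ t′≡)))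
        (ρ * ρ * ρ , *-≢0 (*-≢0 ρ≢0 ρ≢0) ρ≢0 , directrixPoint-scale u v ρ s t)

    directrix-isDirectrix : ∀ u v {S} → S ≐ directrix u v → IsDirectrix S
    directrix-isDirectrix u v {S} (S⊆ , ⊆S) = (frame u v , frame-independent u v , spanned , disjoint) , meets
      where
      spanned : ∀ w → NonZero w → S w → InSpan4 (frame u v) w
      spanned w w≢0 w∈S = span (S⊆ w w≢0 w∈S)
        where
        span : directrix u v w → InSpan4 (frame u v) w
        span (s , t , _ , κ , _ , e) = (λ j → κ * monomials s t j) , λ i → trans (e i) (trans (cong (κ *_) (sym (point-frame u v s t i)))
          (solve 9 (λ κ a b c d x y z w → κ :* (x :* a :+ y :* b :+ z :* c :+ w :* d) := κ :* x :* a :+ κ :* y :* b :+ κ :* z :* c :+ κ :* w :* d) refl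
            κ (frame u v 0F i) (frame u v 1F i) (frame u v 2F i) (frame u v 3F i) (monomials s t 0F) (monomials s t 1F) (monomials s t 2F) (monomials s t 3F)))

      disjoint : ∀ w → NonZero w → InSpan4 (frame u v) w → ¬ α w
      disjoint w w≢0 (c , e) w∈α = w≢0 λ i → trans (e i) (trans (∙-cong {q = λ k → frame u v k i} c≡0 (λ _ → refl))
          (solve 4 (λ x y z w → :0 :* x :+ :0 :* y :+ :0 :* z :+ :0 :* w := :0) refl (frame u v 0F i) (frame u v 1F i) (frame u v 2F i) (frame u v 3F i)))
        where
        c≡0 : Zero c
        c≡0 = apply-zero⇒zero φ₁₁ φ₁₂ φ₂₁ φ₂₂ det≢0 λ i → trans (sym (e (suc (suc (suc i))))) (w∈α i)

      meets : MeetsEachGeneratorOnce S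
      meets s t ok = (directrixPoint u v s t , directrixPoint-nonzero u v ok
                       , ⊆S _ (directrixPoint-nonzero u v ok) (s , t , ok , ≗⇒∼ λ _ → refl) , u * s + v * t , 1# , λ _ → refl)
                   , λ w w′ w≢0 w′≢0 w∈S w∈g w′∈S w′∈g → ∼-trans (on-generator⇒∼ {u} {v} ok (S⊆ w w≢0 w∈S) w∈g)
                       (∼-sym (on-generator⇒∼ {u} {v} ok (S⊆ w′ w′≢0 w′∈S) w′∈g))

  -- Three linear forms in four variables

  det₃ : (x₀ x₁ x₂ y₀ y₁ y₂ z₀ z₁ z₂ : Carrier) → Carrier
  det₃ x₀ x₁ x₂ y₀ y₁ y₂ z₀ z₁ z₂ = x₀ * (y₁ * z₂ + - (y₂ * z₁)) + - (x₁ * (y₀ * z₂ + - (y₂ * z₀))) + x₂ * (y₀ * z₁ + - (y₁ * z₀))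

  -- Cofactors give elements of the kernel: the 3×3 minors first, and when these vanish the 2×2 minors, then the entries.
  nontrivial-kernel : ∀ (x y z : Cubic) → ¬ (∀ c → c ∙ x ≡ 0# → c ∙ y ≡ 0# → c ∙ z ≡ 0# → Zero c)
  -- Assuming a trivial kernel avoids distinguishing ranks: each candidate is itself forced to
  -- vanish, until all three first coordinates are zero and the first unit vector is a kernel
  -- element.
  nontrivial-kernel x y z trivial = 0≢1 (sym (trivial (cubic 1# 0# 0# 0#) (unit x x₀≡0) (unit y y₀≡0) (unit z z₀≡0) 0F))
    where
    :det₃ : ∀ {n} (x₀ x₁ x₂ y₀ y₁ y₂ z₀ z₁ z₂ : Polynomial n) → Polynomial n
    :det₃ x₀ x₁ x₂ y₀ y₁ y₂ z₀ z₁ z₂ = x₀ :* (y₁ :* z₂ :+ :- (y₂ :* z₁)) :+ :- (x₁ :* (y₀ :* z₂ :+ :- (y₂ :* z₀))) :+ x₂ :* (y₀ :* z₁ :+ :- (y₁ :* z₀))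

    D : Carrier
    D = det₃ (x 0F) (x 1F) (x 2F) (y 0F) (y 1F) (y 2F) (z 0F) (z 1F) (z 2F)

    minors : Cubic
    minors = cubic (- det₃ (x 1F) (x 2F) (x 3F) (y 1F) (y 2F) (y 3F) (z 1F) (z 2F) (z 3F)) (det₃ (x 0F) (x 2F) (x 3F) (y 0F) (y 2F) (y 3F) (z 0F) (z 2F) (z 3F))
      (- det₃ (x 0F) (x 1F) (x 3F) (y 0F) (y 1F) (y 3F) (z 0F) (z 1F) (z 3F)) D

    :minors : ∀ {n} (w₀ w₁ w₂ w₃ x₀ x₁ x₂ x₃ y₀ y₁ y₂ y₃ z₀ z₁ z₂ z₃ : Polynomial n) → Polynomial n
    :minors w₀ w₁ w₂ w₃ x₀ x₁ x₂ x₃ y₀ y₁ y₂ y₃ z₀ z₁ z₂ z₃ = (:- :det₃ x₁ x₂ x₃ y₁ y₂ y₃ z₁ z₂ z₃) :* w₀ :+ :det₃ x₀ x₂ x₃ y₀ y₂ y₃ z₀ z₂ z₃ :* w₁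
      :+ (:- :det₃ x₀ x₁ x₃ y₀ y₁ y₃ z₀ z₁ z₃) :* w₂ :+ :det₃ x₀ x₁ x₂ y₀ y₁ y₂ z₀ z₁ z₂ :* w₃

    D≡0 : D ≡ 0#
    D≡0 = trivial minors
      -- Pairing the signed minors with one of the three rows gives a 4×4 determinant with a
      -- repeated row.
      (solve 12 (λ x₀ x₁ x₂ x₃ y₀ y₁ y₂ y₃ z₀ z₁ z₂ z₃ → :minors x₀ x₁ x₂ x₃ x₀ x₁ x₂ x₃ y₀ y₁ y₂ y₃ z₀ z₁ z₂ z₃ := :0) refl
        (x 0F) (x 1F) (x 2F) (x 3F) (y 0F) (y 1F) (y 2F) (y 3F) (z 0F) (z 1F) (z 2F) (z 3F))
      (solve 12 (λ x₀ x₁ x₂ x₃ y₀ y₁ y₂ y₃ z₀ z₁ z₂ z₃ → :minors y₀ y₁ y₂ y₃ x₀ x₁ x₂ x₃ y₀ y₁ y₂ y₃ z₀ z₁ z₂ z₃ := :0) refl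
        (x 0F) (x 1F) (x 2F) (x 3F) (y 0F) (y 1F) (y 2F) (y 3F) (z 0F) (z 1F) (z 2F) (z 3F))
      (solve 12 (λ x₀ x₁ x₂ x₃ y₀ y₁ y₂ y₃ z₀ z₁ z₂ z₃ → :minors z₀ z₁ z₂ z₃ x₀ x₁ x₂ x₃ y₀ y₁ y₂ y₃ z₀ z₁ z₂ z₃ := :0) refl
        (x 0F) (x 1F) (x 2F) (x 3F) (y 0F) (y 1F) (y 2F) (y 3F) (z 0F) (z 1F) (z 2F) (z 3F))
      3F

    -- The cross product on the first three coordinates kills both factors, and also the third
    -- vector because `D` is zero.
    cross : Cubic → Cubic → Cubic
    cross p q = cubic (p 1F * q 2F + - (p 2F * q 1F)) (p 2F * q 0F + - (p 0F * q 2F)) (p 0F * q 1F + - (p 1F * q 0F)) 0#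

    :cross : ∀ {n} (p₀ p₁ p₂ q₀ q₁ q₂ w₀ w₁ w₂ w₃ : Polynomial n) → Polynomial n
    :cross p₀ p₁ p₂ q₀ q₁ q₂ w₀ w₁ w₂ w₃ = (p₁ :* q₂ :+ :- (p₂ :* q₁)) :* w₀ :+ (p₂ :* q₀ :+ :- (p₀ :* q₂)) :* w₁ :+ (p₀ :* q₁ :+ :- (p₁ :* q₀)) :* w₂ :+ :0 :* w₃

    crossˡ : ∀ p q → cross p q ∙ p ≡ 0#
    crossˡ p q = solve 7 (λ p₀ p₁ p₂ p₃ q₀ q₁ q₂ → :cross p₀ p₁ p₂ q₀ q₁ q₂ p₀ p₁ p₂ p₃ := :0) refl (p 0F) (p 1F) (p 2F) (p 3F) (q 0F) (q 1F) (q 2F)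

    crossʳ : ∀ p q → cross p q ∙ q ≡ 0#
    crossʳ p q = solve 7 (λ p₀ p₁ p₂ q₀ q₁ q₂ q₃ → :cross p₀ p₁ p₂ q₀ q₁ q₂ q₀ q₁ q₂ q₃ := :0) refl (p 0F) (p 1F) (p 2F) (q 0F) (q 1F) (q 2F) (q 3F)

    triple : ∀ p q r → cross p q ∙ r ≡ det₃ (p 0F) (p 1F) (p 2F) (q 0F) (q 1F) (q 2F) (r 0F) (r 1F) (r 2F)
    triple p q r = solve 10 (λ p₀ p₁ p₂ q₀ q₁ q₂ r₀ r₁ r₂ r₃ → :cross p₀ p₁ p₂ q₀ q₁ q₂ r₀ r₁ r₂ r₃ := :det₃ p₀ p₁ p₂ q₀ q₁ q₂ r₀ r₁ r₂) refl
      (p 0F) (p 1F) (p 2F) (q 0F) (q 1F) (q 2F) (r 0F) (r 1F) (r 2F) (r 3F)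

    xy≡0 : x 0F * y 1F + - (x 1F * y 0F) ≡ 0#
    xy≡0 = trivial (cross x y) (crossˡ x y) (crossʳ x y) (trans (triple x y z) D≡0) 2F

    yz≡0 : y 0F * z 1F + - (y 1F * z 0F) ≡ 0#
    yz≡0 = trivial (cross y z) (trans (triple y z x) (trans (solve 9 (λ x₀ x₁ x₂ y₀ y₁ y₂ z₀ z₁ z₂ → :det₃ y₀ y₁ y₂ z₀ z₁ z₂ x₀ x₁ x₂ := :det₃ x₀ x₁ x₂ y₀ y₁ y₂ z₀ z₁ z₂) refl
      (x 0F) (x 1F) (x 2F) (y 0F) (y 1F) (y 2F) (z 0F) (z 1F) (z 2F)) D≡0)) (crossˡ y z) (crossʳ y z) 2F

    zx≡0 : z 0F * x 1F + - (z 1F * x 0F) ≡ 0#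
    zx≡0 = trivial (cross z x) (crossʳ z x) (trans (triple z x y) (trans (solve 9 (λ x₀ x₁ x₂ y₀ y₁ y₂ z₀ z₁ z₂ → :det₃ z₀ z₁ z₂ x₀ x₁ x₂ y₀ y₁ y₂ := :det₃ x₀ x₁ x₂ y₀ y₁ y₂ z₀ z₁ z₂) refl
      (x 0F) (x 1F) (x 2F) (y 0F) (y 1F) (y 2F) (z 0F) (z 1F) (z 2F)) D≡0)) (crossˡ z x) 2F

    swap : Cubic → Cubic
    swap p = cubic (p 1F) (- p 0F) 0# 0#

    swap-self : ∀ p → swap p ∙ p ≡ 0#
    swap-self p = solve 4 (λ p₀ p₁ p₂ p₃ → p₁ :* p₀ :+ (:- p₀) :* p₁ :+ :0 :* p₂ :+ :0 :* p₃ := :0) refl (p 0F) (p 1F) (p 2F) (p 3F)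

    swap-∙ : ∀ p q → p 0F * q 1F + - (p 1F * q 0F) ≡ 0# → swap p ∙ q ≡ 0#
    swap-∙ p q e = trans (solve 6 (λ p₀ p₁ q₀ q₁ q₂ q₃ → p₁ :* q₀ :+ (:- p₀) :* q₁ :+ :0 :* q₂ :+ :0 :* q₃ := :- (p₀ :* q₁ :+ :- (p₁ :* q₀))) refl
      (p 0F) (p 1F) (q 0F) (q 1F) (q 2F) (q 3F)) (trans (cong -_ e) (solve 0 (:- :0 := :0) refl))

    swap-∙′ : ∀ p q → q 0F * p 1F + - (q 1F * p 0F) ≡ 0# → swap p ∙ q ≡ 0#
    swap-∙′ p q e = trans (solve 6 (λ p₀ p₁ q₀ q₁ q₂ q₃ → p₁ :* q₀ :+ (:- p₀) :* q₁ :+ :0 :* q₂ :+ :0 :* q₃ := q₀ :* p₁ :+ :- (q₁ :* p₀)) refl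
      (p 0F) (p 1F) (q 0F) (q 1F) (q 2F) (q 3F)) e

    negated : ∀ {a} → - a ≡ 0# → a ≡ 0#
    negated {a} e = trans (solve 1 (λ a → a := :- (:- a)) refl a) (trans (cong -_ e) (solve 0 (:- :0 := :0) refl))

    x₀≡0 : x 0F ≡ 0#
    x₀≡0 = negated (trivial (swap x) (swap-self x) (swap-∙ x y xy≡0) (swap-∙′ x z zx≡0) 1F)

    y₀≡0 : y 0F ≡ 0#
    y₀≡0 = negated (trivial (swap y) (swap-∙′ y x xy≡0) (swap-self y) (swap-∙ y z yz≡0) 1F)

    z₀≡0 : z 0F ≡ 0#
    z₀≡0 = negated (trivial (swap z) (swap-∙ z x zx≡0) (swap-∙′ z y yz≡0) (swap-self z) 1F)

    unit : ∀ p → p 0F ≡ 0# → cubic 1# 0# 0# 0# ∙ p ≡ 0#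
    unit p e = trans (solve 4 (λ p₀ p₁ p₂ p₃ → :1 :* p₀ :+ :0 :* p₁ :+ :0 :* p₂ :+ :0 :* p₃ := p₀) refl (p 0F) (p 1F) (p 2F) (p 3F)) e

  -- Reparametrisations and coordinate changes

  ∙-zeroʳ : ∀ c {p} → Zero p → c ∙ p ≡ 0#
  ∙-zeroʳ c {p} e = trans (∙-cong {c} {c} {p} {λ _ → 0#} (λ _ → refl) e)
    (solve 4 (λ x y z w → x :* :0 :+ y :* :0 :+ z :* :0 :+ w :* :0 := :0) refl (c 0F) (c 1F) (c 2F) (c 3F))

  ∙-+ : ∀ c p q → c ∙ (λ k → p k + q k) ≡ c ∙ p + c ∙ q
  ∙-+ c p q = solve 12 (λ p₀ p₁ p₂ p₃ q₀ q₁ q₂ q₃ c₀ c₁ c₂ c₃ → c₀ :* (p₀ :+ q₀) :+ c₁ :* (p₁ :+ q₁) :+ c₂ :* (p₂ :+ q₂) :+ c₃ :* (p₃ :+ q₃)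
      := (c₀ :* p₀ :+ c₁ :* p₁ :+ c₂ :* p₂ :+ c₃ :* p₃) :+ (c₀ :* q₀ :+ c₁ :* q₁ :+ c₂ :* q₂ :+ c₃ :* q₃)) refl
    (p 0F) (p 1F) (p 2F) (p 3F) (q 0F) (q 1F) (q 2F) (q 3F) (c 0F) (c 1F) (c 2F) (c 3F)

  ∙-* : ∀ c p r → c ∙ (λ k → p k * r) ≡ c ∙ p * r
  ∙-* c p r = solve 9 (λ p₀ p₁ p₂ p₃ c₀ c₁ c₂ c₃ r → c₀ :* (p₀ :* r) :+ c₁ :* (p₁ :* r) :+ c₂ :* (p₂ :* r) :+ c₃ :* (p₃ :* r)
      := (c₀ :* p₀ :+ c₁ :* p₁ :+ c₂ :* p₂ :+ c₃ :* p₃) :* r) refl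
    (p 0F) (p 1F) (p 2F) (p 3F) (c 0F) (c 1F) (c 2F) (c 3F) r

  -- The frame after the substitution (s,t) ↦ (s, r s + t), which gives the point of parameter (1,r)
  -- the new parameter (1,0).
  shift : Carrier → (Fin 4 → Vec7) → Fin 4 → Vec7
  shift r a 0F = point a 1# r
  shift r a 1F i = a 1F i + (r + r) * a 2F i + (r + r + r) * r * a 3F i
  shift r a 2F i = a 2F i + (r + r + r) * a 3F i
  shift r a 3F = a 3F

  point-shift : ∀ r a s t → point (shift r a) s t ≗ point a s (r * s + t)
  point-shift r a s t i = solve 7 (λ a₀ a₁ a₂ a₃ r s t →
      :form (:form a₀ a₁ a₂ a₃ :1 r) (a₁ :+ (r :+ r) :* a₂ :+ (r :+ r :+ r) :* r :* a₃) (a₂ :+ (r :+ r :+ r) :* a₃) a₃ s t := :form a₀ a₁ a₂ a₃ s (r :* s :+ t)) refl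
    (a 0F i) (a 1F i) (a 2F i) (a 3F i) r s t

  shift-independent : ∀ r {a} → LinIndep4 a → LinIndep4 (shift r a)
  shift-independent r {a} indep c e = zeros
    where
    -- Coordinates of `comb c (shift r a)` with respect to `a`. They depend on `c` through a
    -- unitriangular matrix, so the entries of `c` vanish one after another.
    c₁ c₂ c₃ : Carrier
    c₁ = r * c 0F + c 1F
    c₂ = r * r * c 0F + (r + r) * c 1F + c 2F
    c₃ = r * r * r * c 0F + (r + r + r) * r * c 1F + (r + r + r) * c 2F + c 3F

    c′≡0 : Zero (cubic (c 0F) c₁ c₂ c₃)
    c′≡0 = indep (cubic (c 0F) c₁ c₂ c₃) λ i → trans (sym (solve 9 (λ a₀ a₁ a₂ a₃ d₀ d₁ d₂ d₃ r →
        d₀ :* :form a₀ a₁ a₂ a₃ :1 r :+ d₁ :* (a₁ :+ (r :+ r) :* a₂ :+ (r :+ r :+ r) :* r :* a₃) :+ d₂ :* (a₂ :+ (r :+ r :+ r) :* a₃) :+ d₃ :* a₃ :=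
        d₀ :* a₀ :+ (r :* d₀ :+ d₁) :* a₁ :+ (r :* r :* d₀ :+ (r :+ r) :* d₁ :+ d₂) :* a₂ :+ (r :* r :* r :* d₀ :+ (r :+ r :+ r) :* r :* d₁ :+ (r :+ r :+ r) :* d₂ :+ d₃) :* a₃) refl
        (a 0F i) (a 1F i) (a 2F i) (a 3F i) (c 0F) (c 1F) (c 2F) (c 3F) r)) (e i)

    c₁≡0 : c 1F ≡ 0#
    c₁≡0 = trans (solve 2 (λ r d₁ → d₁ := r :* :0 :+ d₁) refl r (c 1F)) (trans (cong (λ d₀ → r * d₀ + c 1F) (sym (c′≡0 0F))) (c′≡0 1F))

    c₂≡0 : c 2F ≡ 0#
    c₂≡0 = trans (solve 2 (λ r d₂ → d₂ := r :* r :* :0 :+ (r :+ r) :* :0 :+ d₂) refl r (c 2F))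
      (trans (cong₂ (λ d₀ d₁ → r * r * d₀ + (r + r) * d₁ + c 2F) (sym (c′≡0 0F)) (sym c₁≡0)) (c′≡0 2F))

    c₃≡0 : c 3F ≡ 0#
    c₃≡0 = trans (solve 2 (λ r d₃ → d₃ := r :* r :* r :* :0 :+ (r :+ r :+ r) :* r :* :0 :+ (r :+ r :+ r) :* :0 :+ d₃) refl r (c 3F))
      (trans (cong₂ (λ d₀ d₁ → r * r * r * d₀ + (r + r + r) * r * d₁ + (r + r + r) * 0# + c 3F) (sym (c′≡0 0F)) (sym c₁≡0))
      (trans (cong (λ d₂ → r * r * r * c 0F + (r + r + r) * r * c 1F + (r + r + r) * d₂ + c 3F) (sym c₂≡0)) (c′≡0 3F)))

    zeros : Zero c
    zeros 0F = c′≡0 0F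
    zeros 1F = c₁≡0
    zeros 2F = c₂≡0
    zeros 3F = c₃≡0

  squareOf : (l₁ l₂ m₁ m₂ : Carrier) → Fin 3 → Carrier
  squareOf l₁ l₂ m₁ m₂ 0F = l₁ * m₁
  squareOf l₁ l₂ m₁ m₂ 1F = l₁ * m₂ + l₂ * m₁
  squareOf l₁ l₂ m₁ m₂ 2F = l₂ * m₂

  module SymmetricSquare (l₁ l₂ m₁ m₂ : Carrier) where

    row : Fin 3 → Fin 3 → Carrier
    row 0F = squareOf l₁ l₂ l₁ l₂
    row 1F = squareOf l₁ l₂ m₁ m₂
    row 2F = squareOf m₁ m₂ m₁ m₂

    apply : (Fin 3 → Carrier) → Fin 3 → Carrier
    apply x i = x 0F * row i 0F + x 1F * row i 1F + x 2F * row i 2F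

    apply-cong : ∀ {x y} → x ≗ y → apply x ≗ apply y
    apply-cong e i = cong₂ _+_ (cong₂ _+_ (cong (_* row i 0F) (e 0F)) (cong (_* row i 1F) (e 1F))) (cong (_* row i 2F) (e 2F))

  module _ (l₁ l₂ m₁ m₂ : Carrier) where
    open SymmetricSquare l₁ l₂ m₁ m₂
    private module Adjugate = SymmetricSquare m₂ (- l₂) (- m₁) l₁

    adjugate-square : ∀ x i → let δ = l₁ * m₂ + - (l₂ * m₁) in Adjugate.apply (apply x) i ≡ δ * δ * x i
    adjugate-square x = λ where
        0F → solve 7 (λ x₀ x₁ x₂ l₁ l₂ m₁ m₂ → let δ = l₁ :* m₂ :+ :- (l₂ :* m₁) in :inverse x₀ x₁ x₂ l₁ l₂ m₁ m₂ m₂ (:- l₂) m₂ (:- l₂) := δ :* δ :* x₀) refl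
               (x 0F) (x 1F) (x 2F) l₁ l₂ m₁ m₂
        1F → solve 7 (λ x₀ x₁ x₂ l₁ l₂ m₁ m₂ → let δ = l₁ :* m₂ :+ :- (l₂ :* m₁) in :inverse x₀ x₁ x₂ l₁ l₂ m₁ m₂ m₂ (:- l₂) (:- m₁) l₁ := δ :* δ :* x₁) refl
               (x 0F) (x 1F) (x 2F) l₁ l₂ m₁ m₂
        2F → solve 7 (λ x₀ x₁ x₂ l₁ l₂ m₁ m₂ → let δ = l₁ :* m₂ :+ :- (l₂ :* m₁) in :inverse x₀ x₁ x₂ l₁ l₂ m₁ m₂ (:- m₁) l₁ (:- m₁) l₁ := δ :* δ :* x₂) refl
               (x 0F) (x 1F) (x 2F) l₁ l₂ m₁ m₂
      where
      :square : ∀ {n} (x₀ x₁ x₂ l₁ l₂ m₁ m₂ : Polynomial n) → Polynomial n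
      :square x₀ x₁ x₂ l₁ l₂ m₁ m₂ = x₀ :* (l₁ :* m₁) :+ x₁ :* (l₁ :* m₂ :+ l₂ :* m₁) :+ x₂ :* (l₂ :* m₂)

      :inverse : ∀ {n} (x₀ x₁ x₂ l₁ l₂ m₁ m₂ l₁′ l₂′ m₁′ m₂′ : Polynomial n) → Polynomial n
      :inverse x₀ x₁ x₂ l₁ l₂ m₁ m₂ = :square (:square x₀ x₁ x₂ l₁ l₂ l₁ l₂) (:square x₀ x₁ x₂ l₁ l₂ m₁ m₂) (:square x₀ x₁ x₂ m₁ m₂ m₁ m₂)

    square-injective : l₁ * m₂ + - (l₂ * m₁) ≢ 0# → ∀ {x y} → apply x ≗ apply y → x ≗ y
    square-injective δ≢0 {x} {y} e i = *-cancelˡ (*-≢0 δ≢0 δ≢0)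
      (trans (sym (adjugate-square x i)) (trans (Adjugate.apply-cong {apply x} {apply y} e i) (adjugate-square y i)))

  conicPart : Vec7 → Fin 3 → Carrier
  conicPart w 0F = w 0F
  conicPart w 1F = w 1F
  conicPart w 2F = w 2F

  -- The linear map of F⁷ that acts on parameters by (l,m) in the plane of the conic and by (l′,m′) in the 3-space of the cubic.
  module CoordinateChange (l₁ l₂ m₁ m₂ l₁′ l₂′ m₁′ m₂′ : Carrier) where
    private
      module Square = SymmetricSquare l₁ l₂ m₁ m₂
      module Cube = SymmetricCube l₁′ l₂′ m₁′ m₂′

    change : Vec7 → Vec7
    change w 0F = Square.apply (conicPart w) 0F
    change w 1F = Square.apply (conicPart w) 1F
    change w 2F = Square.apply (conicPart w) 2F
    change w (suc (suc (suc i))) = Cube.apply (twcPart w) i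

    change-comb : ∀ c a i → change (comb c a) i ≡ c ∙ (λ k → change (a k) i)
    change-comb c a = λ where
        0F → linear₃ (Square.row 0F)
        1F → linear₃ (Square.row 1F)
        2F → linear₃ (Square.row 2F)
        (suc (suc (suc i))) → linear₄ (Cube.row i)
      where
      linear₃ : ∀ (r : Fin 3 → Carrier) → comb c a 0F * r 0F + comb c a 1F * r 1F + comb c a 2F * r 2F ≡ c ∙ (λ k → a k 0F * r 0F + a k 1F * r 1F + a k 2F * r 2F)
      linear₃ r = sym (trans (∙-+ c (λ k → a k 0F * r 0F + a k 1F * r 1F) (λ k → a k 2F * r 2F))
        (cong₂ _+_ (trans (∙-+ c (λ k → a k 0F * r 0F) (λ k → a k 1F * r 1F))
          (cong₂ _+_ (∙-* c (λ k → a k 0F) (r 0F)) (∙-* c (λ k → a k 1F) (r 1F)))) (∙-* c (λ k → a k 2F) (r 2F))))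

      linear₄ : ∀ (r : Cubic) → twcPart (comb c a) ∙ r ≡ c ∙ (λ k → twcPart (a k) ∙ r)
      linear₄ r = sym (trans (∙-+ c (λ k → a k 3F * r 0F + a k 4F * r 1F + a k 5F * r 2F) (λ k → a k 6F * r 3F))
        (cong₂ _+_ (trans (∙-+ c (λ k → a k 3F * r 0F + a k 4F * r 1F) (λ k → a k 5F * r 2F))
          (cong₂ _+_ (trans (∙-+ c (λ k → a k 3F * r 0F) (λ k → a k 4F * r 1F))
            (cong₂ _+_ (∙-* c (λ k → a k 3F) (r 0F)) (∙-* c (λ k → a k 4F) (r 1F)))) (∙-* c (λ k → a k 5F) (r 2F)))) (∙-* c (λ k → a k 6F) (r 3F))))

    change-cong : ∀ {u w} → u ≗ w → change u ≗ change w
    change-cong {u} {w} e = λ where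
        0F → Square.apply-cong {conicPart u} {conicPart w} conic 0F
        1F → Square.apply-cong {conicPart u} {conicPart w} conic 1F
        2F → Square.apply-cong {conicPart u} {conicPart w} conic 2F
        (suc (suc (suc i))) → ∙-cong {q = Cube.row i} (λ j → e (suc (suc (suc j)))) (λ _ → refl)
      where
      conic : conicPart u ≗ conicPart w
      conic 0F = e 0F
      conic 1F = e 1F
      conic 2F = e 2F

    change-injective : l₁ * m₂ + - (l₂ * m₁) ≢ 0# → l₁′ * m₂′ + - (l₂′ * m₁′) ≢ 0# → ∀ {u w} → change u ≗ change w → u ≗ w
    change-injective δ≢0 δ′≢0 {u} {w} e = λ where
        0F → conic 0F
        1F → conic 1F
        2F → conic 2F
        (suc (suc (suc i))) → apply-injective l₁′ l₂′ m₁′ m₂′ δ′≢0 {twcPart u} {twcPart w} (λ j → e (suc (suc (suc j)))) i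
      where
      image : ∀ i → Square.apply (conicPart u) i ≡ Square.apply (conicPart w) i
      image 0F = e 0F
      image 1F = e 1F
      image 2F = e 2F

      conic : conicPart u ≗ conicPart w
      conic = square-injective l₁ l₂ m₁ m₂ δ≢0 {conicPart u} {conicPart w} image

    change-zero : ∀ i → change (λ _ → 0#) i ≡ 0#
    change-zero = λ where
        0F → square-zero (Square.row 0F)
        1F → square-zero (Square.row 1F)
        2F → square-zero (Square.row 2F)
        (suc (suc (suc i))) → cube-zero (Cube.row i)
      where
      square-zero : ∀ (r : Fin 3 → Carrier) → 0# * r 0F + 0# * r 1F + 0# * r 2F ≡ 0#
      square-zero r = solve 3 (λ x y z → :0 :* x :+ :0 :* y :+ :0 :* z := :0) refl (r 0F) (r 1F) (r 2F)
      cube-zero : ∀ (r : Cubic) → (λ _ → 0#) ∙ r ≡ 0#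
      cube-zero r = solve 4 (λ x y z w → :0 :* x :+ :0 :* y :+ :0 :* z :+ :0 :* w := :0) refl (r 0F) (r 1F) (r 2F) (r 3F)

    change-conic+cubic : ∀ λ′ μ s t σ τ → change (conic+cubic λ′ μ s t σ τ) ≗ conic+cubic λ′ μ (l₁ * s + l₂ * t) (m₁ * s + m₂ * t) (l₁′ * σ + l₂′ * τ) (m₁′ * σ + m₂′ * τ)
    change-conic+cubic λ′ μ s t σ τ = λ where
        0F → solve 6 (λ λ′ μ s t l₁ l₂ → :square λ′ μ s t l₁ l₂ l₁ l₂) refl λ′ μ s t l₁ l₂
        1F → solve 8 (λ λ′ μ s t l₁ l₂ m₁ m₂ → :square λ′ μ s t l₁ l₂ m₁ m₂) refl λ′ μ s t l₁ l₂ m₁ m₂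
        2F → solve 6 (λ λ′ μ s t m₁ m₂ → :square λ′ μ s t m₁ m₂ m₁ m₂) refl λ′ μ s t m₁ m₂
        (suc (suc (suc i))) → trans (∙-cong {q = Cube.row i} (twcPart-conic+cubic λ′ μ s t σ τ) (λ _ → refl))
          (trans (Cube.apply-monomials μ σ τ i) (sym (twcPart-conic+cubic λ′ μ (l₁ * s + l₂ * t) (m₁ * s + m₂ * t) (l₁′ * σ + l₂′ * τ) (m₁′ * σ + m₂′ * τ) i)))
      where
      :square : ∀ {n} (λ′ μ s t l₁ l₂ m₁ m₂ : Polynomial n) → Polynomial n × Polynomial n
      :square λ′ μ s t l₁ l₂ m₁ m₂ = let x₀ = λ′ :* (s :* s) :+ μ :* :0 ; x₁ = λ′ :* (s :* t) :+ μ :* :0 ; x₂ = λ′ :* (t :* t) :+ μ :* :0 in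
        (x₀ :* (l₁ :* m₁) :+ x₁ :* (l₁ :* m₂ :+ l₂ :* m₁) :+ x₂ :* (l₂ :* m₂)) := (λ′ :* ((l₁ :* s :+ l₂ :* t) :* (m₁ :* s :+ m₂ :* t)) :+ μ :* :0)

  -- Every twisted cubic on the surface is one of the curves

  module Classification (6≤q : 6 ≤ size) (φ : PGL2) where
    open PGL2 φ using (det≢0) renaming (a to φ₁₁; b to φ₁₂; c to φ₂₁; d to φ₂₂)
    open Surface φ
    open OnSurface φ

    V-cong : ∀ {w w′} → w ≗ w′ → V w → V w′
    V-cong e (s , t , ok , λ′ , μ , g) = s , t , ok , λ′ , μ , λ i → trans (sym (e i)) (g i)

    -- If all affine points of the curve lay in α, the cubic forms of the last four coordinates
    -- would vanish, and α, of vector space dimension three, would contain four independent vectors.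
    -- The search through `elements` makes `r` explicit.
    leaves-α : ∀ {a} → LinIndep4 a → ∃[ r ] ¬ Zero (twcPart (point a 1# r))
    leaves-α {a} indep = search (All.all? (λ r → Finₚ.all? (λ i → twcPart (point a 1# r) i ≟ 0#)) elements)
      where
      search : Dec (All (λ r → Zero (twcPart (point a 1# r))) elements) → ∃[ r ] ¬ Zero (twcPart (point a 1# r))
      search (no ¬all) = Any.satisfied (Allₚ.¬All⇒Any¬ (λ r → Finₚ.all? (λ i → twcPart (point a 1# r) i ≟ 0#)) elements ¬all)
      search (yes all) = contradiction
          (λ c c₀ c₁ c₂ → indep c λ where
            0F → c₀
            1F → c₁
            2F → c₂
            (suc (suc (suc i))) → ∙-zeroʳ c (in-α i))
          (nontrivial-kernel (λ k → a k 0F) (λ k → a k 1F) (λ k → a k 2F))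
        where
        in-α : ∀ i → Zero (λ k → twcPart (a k) i)
        in-α i = form-vanishing⇒zero 6≤q (λ k → twcPart (a k) i) λ r → All.lookup all (complete r) i

    module Starting (a : Fin 4 → Vec7) (indep : LinIndep4 a) (a⊆V : ∀ s t → ParamOK s t → V (point a s t))
      (s₀ t₀ λ₀ μ₀ : Carrier) (start : a 0F ≗ generatorPoint λ₀ μ₀ s₀ t₀) (μ₀≢0 : μ₀ ≢ 0#)
      (x y : Carrier) (xs₀+yt₀≡1 : x * s₀ + y * t₀ ≡ 1#) where

      Δ Δ⁻¹ : Carrier
      Δ = φ₁₁ * φ₂₂ + - (φ₁₂ * φ₂₁)
      Δ⁻¹ = proj₁ (inverse Δ det≢0)

      ΔΔ⁻¹≡1 : Δ * Δ⁻¹ ≡ 1#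
      ΔΔ⁻¹≡1 = proj₂ (inverse Δ det≢0)

      -- The substitution (l,m) has determinant 1 and sends (s₀,t₀) to (1,0).
      l m : Carrier → Carrier → Carrier
      l s t = x * s + y * t
      m s t = - t₀ * s + s₀ * t

      -- The coefficients of the form p s + q t composed with the inverse of φ. Using them on the
      -- 3-space makes conic and cubic parameters agree.
      pull₁ pull₂ : Carrier → Carrier → Carrier
      pull₁ p q = Δ⁻¹ * (p * φ₂₂ + - (q * φ₂₁))
      pull₂ p q = Δ⁻¹ * (q * φ₁₁ + - (p * φ₁₂))

      pull-φ : ∀ p q s t → pull₁ p q * (φ₁₁ * s + φ₁₂ * t) + pull₂ p q * (φ₂₁ * s + φ₂₂ * t) ≡ p * s + q * t
      pull-φ p q s t = trans (solve 9 (λ p q s t e a b c d → e :* (p :* d :+ :- (q :* c)) :* (a :* s :+ b :* t) :+ e :* (q :* a :+ :- (p :* b)) :* (c :* s :+ d :* t)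
          := (a :* d :+ :- (b :* c)) :* e :* (p :* s :+ q :* t)) refl p q s t Δ⁻¹ φ₁₁ φ₁₂ φ₂₁ φ₂₂)
        (trans (cong (_* (p * s + q * t)) ΔΔ⁻¹≡1) (*-identityˡ _))

      open CoordinateChange x y (- t₀) s₀ (pull₁ x y) (pull₂ x y) (pull₁ (- t₀) s₀) (pull₂ (- t₀) s₀)

      change-generator : ∀ λ′ μ s t → change (generatorPoint λ′ μ s t) ≗ conic+cubic λ′ μ (l s t) (m s t) (l s t) (m s t)
      change-generator λ′ μ s t i = trans (change-conic+cubic λ′ μ s t _ _ i)
        (cong₂ (λ σ τ → conic+cubic λ′ μ (l s t) (m s t) σ τ i) (pull-φ x y s t) (pull-φ (- t₀) s₀ s t))

      δ≡1 : x * s₀ + - (y * - t₀) ≡ 1#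
      δ≡1 = trans (solve 4 (λ x s₀ y t₀ → x :* s₀ :+ :- (y :* :- t₀) := x :* s₀ :+ y :* t₀) refl x s₀ y t₀) xs₀+yt₀≡1

      -- This determinant is that of (l,m), which is 1, divided by Δ; so Δ times it is 1. The
      -- inserted factors equal to 1 supply the second Δ⁻¹ that the two pulled-back rows contain.
      δ′≢0 : pull₁ x y * pull₂ (- t₀) s₀ + - (pull₂ x y * pull₁ (- t₀) s₀) ≢ 0#
      δ′≢0 e = 0≢1 (sym (begin
        1#                                            ≡⟨ sym ΔΔ⁻¹≡1 ⟩
        Δ * Δ⁻¹                                       ≡⟨ cong (Δ *_) (sym (*-identityʳ Δ⁻¹)) ⟩
        Δ * (Δ⁻¹ * 1#)                                ≡⟨ cong₂ (λ y z → Δ * (y * z)) (sym (*-identityʳ Δ⁻¹)) (sym δ≡1) ⟩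
        Δ * (Δ⁻¹ * 1# * (x * s₀ + - (y * - t₀)))      ≡⟨ cong (λ z → Δ * (Δ⁻¹ * z * (x * s₀ + - (y * - t₀)))) (sym ΔΔ⁻¹≡1) ⟩
        Δ * (Δ⁻¹ * (Δ * Δ⁻¹) * (x * s₀ + - (y * - t₀))) ≡⟨ solve 9 (λ x y s₀ t₀ e a b c d → let Δ = a :* d :+ :- (b :* c) ; δ = x :* s₀ :+ :- (y :* :- t₀) in
             Δ :* (e :* (Δ :* e) :* δ) := Δ :* (e :* (x :* d :+ :- (y :* c)) :* (e :* (s₀ :* a :+ :- ((:- t₀) :* b))) :+ :- (e :* (y :* a :+ :- (x :* b)) :* (e :* ((:- t₀) :* d :+ :- (s₀ :* c))))))
             refl x y s₀ t₀ Δ⁻¹ φ₁₁ φ₁₂ φ₂₁ φ₂₂ ⟩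
        Δ * (pull₁ x y * pull₂ (- t₀) s₀ + - (pull₂ x y * pull₁ (- t₀) s₀)) ≡⟨ cong (Δ *_) e ⟩
        Δ * 0#                                        ≡⟨ zeroʳ Δ ⟩
        0#                                            ∎))
        where open ≡-Reasoning

      injective : ∀ {u w} → change u ≗ change w → u ≗ w
      injective = change-injective (λ e → 0≢1 (trans (sym e) δ≡1)) δ′≢0

      q : Fin 7 → Cubic
      q i k = change (a k) i

      form-q : ∀ s t i → form (q i) s t ≡ change (point a s t) i
      form-q s t i = sym (change-comb (monomials s t) a i)

      onSurface : ∀ s t → ParamOK s t → ∃[ λ′ ] ∃[ μ ] ∃[ σ ] ∃[ τ ] (∀ i → form (q i) s t ≡ conic+cubic λ′ μ σ τ σ τ i)
      onSurface s t ok with a⊆V s t ok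
      ... | s′ , t′ , _ , λ′ , μ , e = λ′ , μ , l s′ t′ , m s′ t′ , λ i → trans (form-q s t i) (trans (change-cong e i) (change-generator λ′ μ s′ t′ i))

      m₀≡0 : m s₀ t₀ ≡ 0#
      m₀≡0 = solve 2 (λ s₀ t₀ → (:- t₀) :* s₀ :+ s₀ :* t₀ := :0) refl s₀ t₀

      q-start : ∀ i → q i 0F ≡ conic+cubic λ₀ μ₀ 1# 0# 1# 0# i
      q-start i = trans (change-cong start i) (trans (change-generator λ₀ μ₀ s₀ t₀ i)
        (cong₂ (λ σ τ → conic+cubic λ₀ μ₀ σ τ σ τ i) xs₀+yt₀≡1 m₀≡0))

      start₃ : q 3F 0F ≢ 0#
      start₃ e = μ₀≢0 (trans (solve 2 (λ λ₀ μ₀ → μ₀ := λ₀ :* :0 :+ μ₀ :* (:1 :* :1 :* :1)) refl λ₀ μ₀) (trans (sym (q-start 3F)) e))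

      start₄ : q 4F 0F ≡ 0#
      start₄ = trans (q-start 4F) (solve 2 (λ λ₀ μ₀ → λ₀ :* :0 :+ μ₀ :* (:1 :* :1 :* :0) := :0) refl λ₀ μ₀)

      start₅ : q 5F 0F ≡ 0#
      start₅ = trans (q-start 5F) (solve 2 (λ λ₀ μ₀ → λ₀ :* :0 :+ μ₀ :* (:1 :* :0 :* :0) := :0) refl λ₀ μ₀)

      start₆ : q 6F 0F ≡ 0#
      start₆ = trans (q-start 6F) (solve 2 (λ λ₀ μ₀ → λ₀ :* :0 :+ μ₀ :* (:0 :* :0 :* :0) := :0) refl λ₀ μ₀)

      open CurvesOnSurface 6≤q q onSurface start₃ start₄ start₅ start₆ using (Collapsed; Parametrised; classification)

      not-collapsed : ¬ Collapsed
      -- Two surviving coordinates cannot separate four independent vectors; the third linear form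
      -- is filled with zero.
      not-collapsed (x₁≡0 , x₂≡0 , y₁≡0 , y₂≡0 , y₃≡0) = nontrivial-kernel (q 0F) (q 3F) (λ _ → 0#) λ c c₀ c₃ _ →
        let killed : ∀ i → c ∙ q i ≡ 0#
            killed = λ where
              0F → c₀
              1F → ∙-zeroʳ c x₁≡0
              2F → ∙-zeroʳ c x₂≡0
              3F → c₃
              4F → ∙-zeroʳ c y₁≡0
              5F → ∙-zeroʳ c y₂≡0
              6F → ∙-zeroʳ c y₃≡0
        in indep c (injective {comb c a} {λ _ → 0#} λ i → trans (change-comb c a i) (trans (killed i) (sym (change-zero i))))

      module Parametrisation (c f₀ f₁ k₀ k₁ : Carrier) (c≢0 : c ≢ 0#) (f₀≢0 : f₀ ≢ 0#)
        (parametrised : ∀ s t i → form (q i) s t ≡ conic+cubic (k₀ * s + k₁ * t) c (f₀ * s + f₁ * t) t (f₀ * s + f₁ * t) t i) where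

        -- In terms of f and t, the form k is k₀ f₀⁻¹ f + κ t. Replacing f and t by l and m and
        -- dividing by c gives the form with coefficients `u` and `v`.
        c⁻¹ f₀⁻¹ κ u v : Carrier
        c⁻¹ = proj₁ (inverse c c≢0)
        f₀⁻¹ = proj₁ (inverse f₀ f₀≢0)
        κ = k₁ + - (k₀ * f₀⁻¹ * f₁)
        u = c⁻¹ * (k₀ * f₀⁻¹ * x + κ * - t₀)
        v = c⁻¹ * (k₀ * f₀⁻¹ * y + κ * s₀)

        -- The point (w₁,w₂) with l(w₁,w₂) = f₀ s + f₁ t and m(w₁,w₂) = t.
        w₁ w₂ : Carrier → Carrier → Carrier
        w₁ s t = s₀ * (f₀ * s + f₁ * t) + - (y * t)
        w₂ s t = t₀ * (f₀ * s + f₁ * t) + x * t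

        l-w : ∀ s t → l (w₁ s t) (w₂ s t) ≡ f₀ * s + f₁ * t
        l-w s t = trans (solve 6 (λ x y s₀ t₀ f t → x :* (s₀ :* f :+ :- (y :* t)) :+ y :* (t₀ :* f :+ x :* t) := (x :* s₀ :+ y :* t₀) :* f) refl x y s₀ t₀ _ t)
          (trans (cong (_* (f₀ * s + f₁ * t)) xs₀+yt₀≡1) (*-identityˡ _))

        m-w : ∀ s t → m (w₁ s t) (w₂ s t) ≡ t
        m-w s t = trans (solve 6 (λ x y s₀ t₀ f t → (:- t₀) :* (s₀ :* f :+ :- (y :* t)) :+ s₀ :* (t₀ :* f :+ x :* t) := (x :* s₀ :+ y :* t₀) :* t) refl x y s₀ t₀ (f₀ * s + f₁ * t) t)
          (trans (cong (_* t) xs₀+yt₀≡1) (*-identityˡ t))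

        w-ok : ∀ {s t} → ParamOK s t → ParamOK (w₁ s t) (w₂ s t)
        w-ok {s} {t} ok (w₁≡0 , w₂≡0) = ok (s≡0 , t≡0)
          where
          t≡0 : t ≡ 0#
          t≡0 = trans (sym (m-w s t)) (trans (cong₂ m w₁≡0 w₂≡0) (solve 2 (λ s₀ t₀ → (:- t₀) :* :0 :+ s₀ :* :0 := :0) refl s₀ t₀))
          f≡0 : f₀ * s + f₁ * t ≡ 0#
          f≡0 = trans (sym (l-w s t)) (trans (cong₂ l w₁≡0 w₂≡0) (solve 2 (λ x y → x :* :0 :+ y :* :0 := :0) refl x y))
          s≡0 : s ≡ 0#
          s≡0 = *-cancelˡ-≡0 f₀≢0 (trans (solve 3 (λ f₀ s f₁ → f₀ :* s := f₀ :* s :+ f₁ :* :0) refl f₀ s f₁) (trans (cong (λ t → f₀ * s + f₁ * t) (sym t≡0)) f≡0))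

        uv-form : ∀ s t → c * (u * w₁ s t + v * w₂ s t) ≡ k₀ * s + k₁ * t
        uv-form s t = begin
          c * (u * w₁ s t + v * w₂ s t)
            ≡⟨ solve 10 (λ c c⁻¹ g κ x y s₀ t₀ w₁ w₂ → c :* (c⁻¹ :* (g :* x :+ κ :* :- t₀) :* w₁ :+ c⁻¹ :* (g :* y :+ κ :* s₀) :* w₂) :=
                 c :* c⁻¹ :* (g :* (x :* w₁ :+ y :* w₂) :+ κ :* ((:- t₀) :* w₁ :+ s₀ :* w₂))) refl c c⁻¹ (k₀ * f₀⁻¹) κ x y s₀ t₀ (w₁ s t) (w₂ s t) ⟩
          c * c⁻¹ * (k₀ * f₀⁻¹ * l (w₁ s t) (w₂ s t) + κ * m (w₁ s t) (w₂ s t))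
            ≡⟨ cong₂ (λ y z → y * z) (proj₂ (inverse c c≢0)) (cong₂ (λ y z → k₀ * f₀⁻¹ * y + κ * z) (l-w s t) (m-w s t)) ⟩
          1# * (k₀ * f₀⁻¹ * (f₀ * s + f₁ * t) + κ * t)
            ≡⟨ solve 7 (λ k₀ k₁ f₀ f₁ e s t → :1 :* (k₀ :* e :* (f₀ :* s :+ f₁ :* t) :+ (k₁ :+ :- (k₀ :* e :* f₁)) :* t) := k₀ :* (f₀ :* e) :* s :+ k₁ :* t) refl k₀ k₁ f₀ f₁ f₀⁻¹ s t ⟩
          k₀ * (f₀ * f₀⁻¹) * s + k₁ * t
            ≡⟨ cong (λ z → z * s + k₁ * t) (trans (cong (k₀ *_) (proj₂ (inverse f₀ f₀≢0))) (*-identityʳ k₀)) ⟩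
          k₀ * s + k₁ * t ∎
          where open ≡-Reasoning

        -- Both points are compared after the injective coordinate change. The scalar is c because
        -- directrix points carry weight 1 on the cubic.
        point-on-directrix : ∀ s t → point a s t ∼ directrixPoint u v (w₁ s t) (w₂ s t)
        point-on-directrix s t = c , c≢0 , λ i → trans (injective {point a s t} {generatorPoint (k₀ * s + k₁ * t) c (w₁ s t) (w₂ s t)} images i)
            (trans (cong₂ (λ y z → generatorPoint y z (w₁ s t) (w₂ s t) i) (sym (uv-form s t)) (sym (*-identityʳ c)))
              (conic+cubic-·-homogeneous c (u * w₁ s t + v * w₂ s t) 1# (w₁ s t) (w₂ s t) _ _ i))
          where
          images : change (point a s t) ≗ change (generatorPoint (k₀ * s + k₁ * t) c (w₁ s t) (w₂ s t))
          images i = trans (sym (form-q s t i)) (trans (parametrised s t i) (sym (trans (change-generator (k₀ * s + k₁ * t) c (w₁ s t) (w₂ s t) i)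
            (cong₂ (λ σ τ → conic+cubic (k₀ * s + k₁ * t) c σ τ σ τ i) (l-w s t) (m-w s t)))))

        -- The equations l = f₀ s + f₁ t and m = t are solved for (s,t) by dividing by f₀. This
        -- yields the inclusion of the directrix in the curve.
        w-surjective : ∀ s′ t′ → ParamOK s′ t′ → ∃[ s ] ∃[ t ] (ParamOK s t × (w₁ s t ≡ s′) × (w₂ s t ≡ t′))
        w-surjective s′ t′ ok′ = s , t , ok , w₁≡ , w₂≡
          where
          open ≡-Reasoning
          s t : Carrier
          t = m s′ t′
          s = f₀⁻¹ * (l s′ t′ + - (f₁ * t))

          f≡l : f₀ * s + f₁ * t ≡ l s′ t′
          f≡l = begin
            f₀ * s + f₁ * t                                  ≡⟨ solve 5 (λ f₀ e l f₁ t → f₀ :* (e :* (l :+ :- (f₁ :* t))) :+ f₁ :* t := f₀ :* e :* (l :+ :- (f₁ :* t)) :+ f₁ :* t) refl f₀ f₀⁻¹ (l s′ t′) f₁ t ⟩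
            f₀ * f₀⁻¹ * (l s′ t′ + - (f₁ * t)) + f₁ * t      ≡⟨ cong (λ z → z * (l s′ t′ + - (f₁ * t)) + f₁ * t) (proj₂ (inverse f₀ f₀≢0)) ⟩
            1# * (l s′ t′ + - (f₁ * t)) + f₁ * t             ≡⟨ solve 3 (λ l f₁ t → :1 :* (l :+ :- (f₁ :* t)) :+ f₁ :* t := l) refl (l s′ t′) f₁ t ⟩
            l s′ t′                                          ∎

          w₁≡ : w₁ s t ≡ s′
          w₁≡ = begin
            s₀ * (f₀ * s + f₁ * t) + - (y * t)               ≡⟨ cong (λ f → s₀ * f + - (y * t)) f≡l ⟩
            s₀ * l s′ t′ + - (y * t)                         ≡⟨ solve 6 (λ x y s₀ t₀ s′ t′ → s₀ :* (x :* s′ :+ y :* t′) :+ :- (y :* ((:- t₀) :* s′ :+ s₀ :* t′)) := (x :* s₀ :+ y :* t₀) :* s′) refl x y s₀ t₀ s′ t′ ⟩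
            (x * s₀ + y * t₀) * s′                           ≡⟨ trans (cong (_* s′) xs₀+yt₀≡1) (*-identityˡ s′) ⟩
            s′                                               ∎

          w₂≡ : w₂ s t ≡ t′
          w₂≡ = begin
            t₀ * (f₀ * s + f₁ * t) + x * t                   ≡⟨ cong (λ f → t₀ * f + x * t) f≡l ⟩
            t₀ * l s′ t′ + x * t                             ≡⟨ solve 6 (λ x y s₀ t₀ s′ t′ → t₀ :* (x :* s′ :+ y :* t′) :+ x :* ((:- t₀) :* s′ :+ s₀ :* t′) := (x :* s₀ :+ y :* t₀) :* t′) refl x y s₀ t₀ s′ t′ ⟩
            (x * s₀ + y * t₀) * t′                           ≡⟨ trans (cong (_* t′) xs₀+yt₀≡1) (*-identityˡ t′) ⟩
            t′                                               ∎

          ok : ParamOK s t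
          ok (s≡0 , t≡0) = ok′ (trans (sym w₁≡) (trans (cong₂ w₁ s≡0 t≡0) (solve 4 (λ s₀ f₀ f₁ y → s₀ :* (f₀ :* :0 :+ f₁ :* :0) :+ :- (y :* :0) := :0) refl s₀ f₀ f₁ y))
                               , trans (sym w₂≡) (trans (cong₂ w₂ s≡0 t≡0) (solve 4 (λ t₀ f₀ f₁ x → t₀ :* (f₀ :* :0 :+ f₁ :* :0) :+ x :* :0 := :0) refl t₀ f₀ f₁ x)))

        curve⊆directrix : ∀ {w} → Curve (point a) w → directrix u v w
        curve⊆directrix = Curve-mono λ s t ok → w₁ s t , w₂ s t , w-ok ok , point-on-directrix s t

        directrix⊆curve : ∀ {w} → directrix u v w → Curve (point a) w
        directrix⊆curve = Curve-mono λ s′ t′ ok′ → preimage (w-surjective s′ t′ ok′)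
          where
          preimage : ∀ {s′ t′} → ∃[ s ] ∃[ t ] (ParamOK s t × (w₁ s t ≡ s′) × (w₂ s t ≡ t′)) → Curve (point a) (directrixPoint u v s′ t′)
          preimage (s , t , ok , refl , refl) = s , t , ok , ∼-sym (point-on-directrix s t)

      isDirectrixCurve : ∃[ u ] ∃[ v ] ((∀ {w} → Curve (point a) w → directrix u v w) × (∀ {w} → directrix u v w → Curve (point a) w))
      isDirectrixCurve = [ (λ collapsed → contradiction collapsed not-collapsed) , directrix-of ]′ classification
        where
        directrix-of : Parametrised → ∃[ u ] ∃[ v ] ((∀ {w} → Curve (point a) w → directrix u v w) × (∀ {w} → directrix u v w → Curve (point a) w))
        directrix-of (c , f₀ , f₁ , k₀ , k₁ , c≢0 , f₀≢0 , e) = u , v , curve⊆directrix , directrix⊆curve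
          where open Parametrisation c f₀ f₁ k₀ k₁ c≢0 f₀≢0 e

    twistedCubic⇒directrix : ∀ {S} → IsTwistedCubic S → S ⊆P V → ∃[ u ] ∃[ v ] (S ≐ directrix u v)
    twistedCubic⇒directrix {S} (a , indep , S⇔) S⊆V = start (leaves-α {a} indep)
      where
      curve⇒S : ∀ {w} → NonZero w → Curve (point a) w → S w
      curve⇒S {w} w≢0 w∈ = proj₂ (S⇔ w w≢0) (Curve⇒affine a w∈)

      a⊆V : ∀ s t → ParamOK s t → V (point a s t)
      a⊆V s t ok = S⊆V _ (point-nonzero {a} indep ok) (curve⇒S (point-nonzero {a} indep ok) (s , t , ok , ≗⇒∼ λ _ → refl))

      start : ∃[ r ] ¬ Zero (twcPart (point a 1# r)) → ∃[ u ] ∃[ v ] (S ≐ directrix u v)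
      start (r , outside-α) = from (a⊆V 1# r 1-x-ok)
        where
        unshift : ∀ s t → r * s + (t + - (r * s)) ≡ t
        unshift s t = solve 3 (λ r s t → r :* s :+ (t :+ :- (r :* s)) := t) refl r s t

        shift-ok : ∀ {s t} → ParamOK s t → ParamOK s (r * s + t)
        shift-ok {s} {t} ok (s≡0 , e) = ok (s≡0 , trans (solve 3 (λ r s t → t := :- r :* s :+ (r :* s :+ t)) refl r s t) (trans (cong₂ (λ s z → - r * s + z) s≡0 e)
          (solve 1 (λ r → :- r :* :0 :+ :0 := :0) refl r)))

        unshift-ok : ∀ {s t} → ParamOK s t → ParamOK s (t + - (r * s))
        unshift-ok {s} {t} ok (s≡0 , e) = ok (s≡0 , trans (sym (unshift s t)) (trans (cong₂ (λ s z → r * s + z) s≡0 e) (solve 1 (λ r → r :* :0 :+ :0 := :0) refl r)))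

        unshift-point : ∀ s t → point a s t ≗ point (shift r a) s (t + - (r * s))
        unshift-point s t i = sym (trans (point-shift r a s (t + - (r * s)) i) (cong (λ t → point a s t i) (unshift s t)))

        from : V (point a 1# r) → ∃[ u ] ∃[ v ] (S ≐ directrix u v)
        from (s₀ , t₀ , ok₀ , λ₀ , μ₀ , e) = conclude isDirectrixCurve
          where
          x y : Carrier
          x = proj₁ (bézout ok₀)
          y = proj₁ (proj₂ (bézout ok₀))

          μ₀≢0 : μ₀ ≢ 0#
          -- With weight 0 on the cubic, the starting point would lie in α.
          μ₀≢0 refl = outside-α λ i → trans (e (suc (suc (suc i)))) (trans (twcPart-conic+cubic λ₀ 0# s₀ t₀ _ _ i) (zeroˡ _))

          -- Column 0 of the shifted frame is by definition the point outside α, so `e` is the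
          -- required description of the start.
          open Starting (shift r a) (shift-independent r {a} indep)
            (λ s t ok → V-cong (λ i → sym (point-shift r a s t i)) (a⊆V s (r * s + t) (shift-ok ok)))
            s₀ t₀ λ₀ μ₀ e μ₀≢0 x y (proj₂ (proj₂ (bézout ok₀))) using (isDirectrixCurve)

          conclude : ∃[ u ] ∃[ v ] ((∀ {w} → Curve (point (shift r a)) w → directrix u v w) × (∀ {w} → directrix u v w → Curve (point (shift r a)) w)) →
            ∃[ u ] ∃[ v ] (S ≐ directrix u v)
          conclude (u , v , ⊆directrix , directrix⊆) = u , v
            , (λ w w≢0 w∈S → ⊆directrix (Curve-mono (λ s t ok → s , t + - (r * s) , unshift-ok ok , ≗⇒∼ (unshift-point s t)) (affine⇒Curve a (proj₁ (S⇔ w w≢0) w∈S))))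
            , (λ w w≢0 w∈T → curve⇒S w≢0 (Curve-mono (λ s t ok → s , r * s + t , shift-ok ok , ≗⇒∼ (point-shift r a s t)) (directrix⊆ w∈T)))

    -- Listing the curves by their linear forms

    parameters : List (Carrier × Carrier)
    parameters = cartesianProduct elements elements

    directrices : List PointSet
    directrices = map (uncurry directrix) parameters

    main : Σ (List PointSet) (λ L →
        (length L ≡ size ℕ.* size)
      × All (λ S → IsTwistedCubic S × (S ⊆P V)) L
      × AllPairs (λ S T → ¬ (S ≐ T)) L
      × (∀ S → IsTwistedCubic S → S ⊆P V → Any (λ T → S ≐ T) L))
      × (∀ S → IsTwistedCubic S → S ⊆P V → IsDirectrix S)
    main = (directrices
        , trans (Listₚ.length-map (uncurry directrix) parameters) (length-cartesianProduct elements elements)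
        , Allₚ.map⁺ (All.universal (λ (u , v) → directrix-isTwistedCubic u v , directrix⊆V u v) parameters)
        , AllPairsₚ.map⁺ (AllPairs.map distinct (Uniqueₚ.cartesianProduct⁺ unique unique))
        , λ S cubicS S⊆V → listed (twistedCubic⇒directrix cubicS S⊆V))
      , λ S cubicS S⊆V → let u , v , S≐ = twistedCubic⇒directrix cubicS S⊆V in directrix-isDirectrix u v S≐
      where
      distinct : ∀ {p q : Carrier × Carrier} → p ≢ q → ¬ (uncurry directrix p ≐ uncurry directrix q)
      distinct p≢q same = p≢q (uncurry (cong₂ _,_) (directrix-injective same))

      listed : ∀ {S} → ∃[ u ] ∃[ v ] (S ≐ directrix u v) → Any (λ T → S ≐ T) directrices
      listed (u , v , S≐) = Anyₚ.map⁺ (Any.map (λ { refl → S≐ }) (∈ₚ.∈-cartesianProduct⁺ (complete u) (complete v)))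

open import Data.Nat using (_*_)

theorem3p2 : (F : FiniteField) → 6 ≤ FiniteField.size F →
  (φ : Geometry.PGL2 F) →
  let open Geometry F in
  let open Surface φ in
  Σ (List PointSet) (λ L →
      (length L ≡ FiniteField.size F * FiniteField.size F)
    × All (λ S → IsTwistedCubic S × (S ⊆P V)) L
    × AllPairs (λ S T → ¬ (S ≐ T)) L
    × (∀ S → IsTwistedCubic S → S ⊆P V → Any (λ T → S ≐ T) L))
  × (∀ S → IsTwistedCubic S → S ⊆P V → IsDirectrix S)
theorem3p2 F 6≤q φ = RuledQuintic.Classification.main F 6≤q φ
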